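{- An affine permutation in $\widetilde S_n$ is uniquely sorted if and only if it is in the image of $\widetilde{\mathtt s}$ and has exactly $\frac n2$ descents. In particular, there are no uniquely sorted affine permutations in $\widetilde S_n$ when $n$ is odd.
   Context: An affine permutation of size $n$ is a bijection $w:\mathbb Z\to\mathbb Z$ with $w(i+n)=w(i)+n$ for all $i\in\mathbb Z$ and $\sum_{i=1}^n w(i)=\binom{n+1}{2}$. They form the affine symmetric group $\widetilde S_n$ under composition, a Coxeter group of type $\widetilde A_{n-1}$ with simple generators $\widetilde s_1,\ldots,\widetilde s_n$, where $\widetilde s_i$ swaps $i+mn$ and $i+mn+1$ for all $m\in\mathbb Z$ and fixes all other integers. The descents of $w$ meant here are its right descents, i.e. the simple generators $\widetilde s_i$, $1\le i\le n$, with $w(i)>w(i+1)$. The left weak order is $x\leq_L y\iff\ell(yx^{ -1})=\ell(y)-\ell(x)$, $\ell$ being Coxeter length; $e$ is the identity. Affine sylvester congruence. For $w\in\widetilde S_n$ define a partial order $\preceq_w$ on $\mathbb Z$ (positions): for $i<j$, the positions $i,j$ are incomparable if and only if there is $k$ with $i<k<j$ and $w(k)>\max\{w(i),w(j)\}$; otherwise the position with the smaller value of $w$ is below the other. (This is the descendant order of the decreasing affine binary plane tree with in-order reading $w$.) The affine sylvester congruence is $v\equiv_{\widetilde{\mathrm{syl}}}w\iff{\preceq_v}={\preceq_w}$; it is a semilattice congruence on $(\widetilde S_n,\leq_L)$ in which $\{e\}$ is a class, and each class has a unique $\leq_L$-minimal element. Let $\pi_\downarrow(w)$ be the minimal element of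 the class of $w$. The affine stack-sorting map is $\widetilde{\mathtt s}:\widetilde S_n\to\widetilde S_n$, $\widetilde{\mathtt s}(w)=w\,(\pi_\downarrow(w))^{ -1}$. The fertility of $w\in\widetilde S_n$ is $\lvert\widetilde{\mathtt s}^{ -1}(w)\rvert$ (which is finite), and $w$ is uniquely sorted if its fertility is $1$. -}

module Defs where

open import Data.Bool.Base using (if_then_else_)
open import Data.Fin.Base using (Fin; toℕ)
open import Data.Integer.Base using (ℤ; +_; _+_; _-_; _⊓_; _⊔_; _<_; _≤_; 1ℤ)
open import Data.Integer.Divisibility.Signed using (_∣?_)
open import Data.Integer.Properties using (_<?_; +-0-monoid)
open import Data.List.Base using (List; length; foldr; filter; allFin)
open import Data.Nat.Base as ℕ using (ℕ; suc)
open import Data.Nat.Combinatorics using (_C_)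
open import Data.Product.Base using (∃-syntax; _×_; proj₁)
open import Function.Base using (_∘_)
open import Function.Bundles using (_↔_; Inverse; Bijection; _⇔_)
open import Level using (0ℓ)
open import Relation.Binary.Bundles using (Setoid)
open import Relation.Binary.PropositionalEquality
  using (_≡_; _≗_; refl; sym; trans; setoid)
open import Relation.Nullary using (¬_)
open import Relation.Nullary.Decidable using (does)

open import Algebra.Properties.Monoid.Sum +-0-monoid using (sum)

-- `Fin n` indexes the window {1, …, n}.
pos : ∀ {n} → Fin n → ℤ
pos i = + suc (toℕ i)

record AffinePermutation (n : ℕ) : Set where
  field
    perm      : ℤ ↔ ℤ
  open Inverse perm public using (to; from)
  field
    periodic  : ∀ i → to (i + + n) ≡ to i + + n
    windowSum : sum {n} (λ i → to (pos i)) ≡ + (suc n C 2)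

open AffinePermutation public using (to; from)

-- Equality in the affine symmetric group: the invertibility and window data
-- carried by the record are irrelevant.
infix 4 _≈_
_≈_ : ∀ {n} → AffinePermutation n → AffinePermutation n → Set
v ≈ w = to v ≗ to w

-- For n ≥ 2 the two residue tests are mutually exclusive, so this swaps
-- i + m n and i + m n + 1 for every m and fixes all other integers.
generator : ∀ {n} → Fin n → ℤ → ℤ
generator {n} i x =
  if does (+ n ∣? (x - pos i)) then x + 1ℤ else
  if does (+ n ∣? (x - (pos i + 1ℤ))) then x - 1ℤ else x

wordProduct : ∀ {n} → List (Fin n) → ℤ → ℤ
wordProduct is x = foldr generator x is

-- Coxeter length, as a relation: k is the least length of a word in the
-- simple generators of type Ã_{n-1} whose product is f.
HasLength : ℕ → (ℤ → ℤ) → ℕ → Set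
HasLength n f k =
  (∃[ is ] wordProduct {n} is ≗ f × length is ≡ k) ×
  (∀ is → wordProduct {n} is ≗ f → k ℕ.≤ length is)

-- Left weak order: ℓ(y x⁻¹) = ℓ(y) - ℓ(x).
infix 4 _≤L_
_≤L_ : ∀ {n} → AffinePermutation n → AffinePermutation n → Set
_≤L_ {n} x y = ∃[ a ] ∃[ b ] ∃[ c ]
  HasLength n (to y ∘ from x) a × HasLength n (to y) b × HasLength n (to x) c ×
  + a ≡ + b - + c

Separated : ∀ {n} → AffinePermutation n → ℤ → ℤ → Set
Separated w i j = ∃[ k ] (i ⊓ j) < k × k < (i ⊔ j) × (to w i ⊔ to w j) < to w k

-- The partial order ≼_w on positions; it is reflexive because nothing lies
-- strictly between i and i.
Below : ∀ {n} → AffinePermutation n → ℤ → ℤ → Set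
Below w i j = ¬ Separated w i j × to w i ≤ to w j

infix 4 _≡syl_
_≡syl_ : ∀ {n} → AffinePermutation n → AffinePermutation n → Set
v ≡syl w = ∀ i j → Below v i j ⇔ Below w i j

-- The graph of π↓: each class has exactly one ≤L-minimal element, so for
-- every w there is, up to _≈_, exactly one u with `IsProjection w u`.
IsProjection : ∀ {n} → AffinePermutation n → AffinePermutation n → Set
IsProjection w u = u ≡syl w × (∀ v → v ≡syl w → v ≤L u → v ≈ u)

-- The graph of the affine stack-sorting map w ↦ w (π↓ w)⁻¹.
StackSortsTo : ∀ {n} → AffinePermutation n → AffinePermutation n → Set
StackSortsTo w x = ∃[ u ] IsProjection w u × to x ≗ to w ∘ from u

InImage : ∀ {n} → AffinePermutation n → Set
InImage w = ∃[ v ] StackSortsTo v w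

-- Preimages are compared as affine permutations only, ignoring the evidence
-- that they are preimages.
preimage : ∀ {n} → AffinePermutation n → Setoid 0ℓ 0ℓ
preimage w = record
  { Carrier       = ∃[ v ] StackSortsTo v w
  ; _≈_           = λ p q → proj₁ p ≈ proj₁ q
  ; isEquivalence = record
    { refl  = λ _ → refl
    ; sym   = λ p i → sym (p i)
    ; trans = λ p q i → trans (p i) (q i)
    }
  }

-- The cardinality of the preimage of w is k.
HasFertility : ∀ {n} → AffinePermutation n → ℕ → Set
HasFertility w k = Bijection (setoid (Fin k)) (preimage w)

UniquelySorted : ∀ {n} → AffinePermutation n → Set
UniquelySorted w = HasFertility w 1

descents : ∀ {n} → AffinePermutation n → List (Fin n)
descents {n} w = filter (λ i → to w (pos i + 1ℤ) <? to w (pos i)) (allFin n)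

{-# OPTIONS --safe #-}

-- Write a preimage of w as w ∘ u, where u is the projection. Projections are
-- exactly the orders u avoiding 231, i.e. the postorders of binary trees with
-- in-order positions ℤ, and w ∘ u is a preimage iff the labels w decrease along
-- the tree of u.
--
-- If i is a descent of w, then i + 1 cannot be the parent of i, so i + 1 is a
-- leaf, i.e. a valley of u. Valleys are never adjacent, so 2 des(w) ≤ n. In the
-- case of equality valleys and peaks alternate, the tree is full, its leaves are
-- the labels i + 1 with i a descent, and a full binary tree is determined by
-- the positions of its leaves in postorder. Otherwise two adjacent positions carry
-- no label of that form, and one of two local moves (a node jumps right over its
-- right subtree, or left over its left child together with the right subtree of
-- that child) gives another tree with the same postorder along which w decreases.
module Submission where

open import Defs
open import Data.Bool.Base using (true; false; if_then_else_)
open import Data.Empty using (⊥; ⊥-elim)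
open import Data.Fin.Base as Fin using (Fin; fromℕ<; inject₁; fromℕ)
open import Data.Fin.Permutation using (Permutation; permutation)
import Data.Fin.Properties as Fin
open import Data.List.Base using (List; []; _∷_; _++_; length; filter; tabulate)
import Data.List.Properties as List
open import Data.Nat.Base as ℕ using (ℕ; zero; suc; z≤n; s≤s)
import Data.Nat.Combinatorics as ℕ
open import Data.Nat.Divisibility using (_∣_; divides)
import Data.Nat.Induction as ℕ
import Data.Nat.Properties as ℕ
open import Data.Product.Base using (∃-syntax; _×_; _,_; proj₁; proj₂)
open import Data.Sum.Base using (_⊎_; inj₁; inj₂)
open import Function.Base using (_∘_; id; case_of_)
open import Function.Bundles using (mk↔ₛ′; Inverse; Bijection; _⇔_; mk⇔; Equivalence)
open import Relation.Binary.Definitions using (tri<; tri≈; tri>)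
open import Relation.Binary.PropositionalEquality
open import Relation.Nullary using (¬_; Dec; yes; no; contradiction)
open import Relation.Nullary.Decidable using (does; dec-true; dec-false; decidable-stable)

-- The step from descents to leaves: after a node the postorder visits its parent or, if the node is
-- a left child and its parent has a right subtree, the first node of that subtree, which is a leaf.
-- A descent of `w` excludes the parent. The tree has no root, since labels grow without bound to
-- the right, so there is no structural induction on it. It enters only through its ancestor
-- relation `Bel`, where j carries the maximum on the interval from i to j. Finite counting becomes
-- summation of periodic functions over a window, and uniqueness is proved on finite intervals of
-- labels. Minimality of projections is defined through lengths of words. The exchange condition
-- turns it into containment of inversions, and a permutation without inversions is the identity
-- because its total displacement over a window is 0. Both moves act on all translates of a node at
-- once. A node passes fewer than n positions, so translates do not interfere; labels stay attached
-- to their nodes and only in-order positions change.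

module _ where

  open import Data.Integer.Base hiding (suc; pos)
  open import Data.Integer.DivMod using (a≡a%ℕn+[a/ℕn]*n; n%ℕd<d)
  import Data.Integer.Divisibility.Signed as ℤ∣
  open import Data.Integer.Properties
  open import Data.Integer.Tactic.RingSolver using (solve-∀)
  open import Algebra.Properties.CommutativeMonoid.Sum +-0-commutativeMonoid
    using (sum; sum-cong-≗; sum-permute; sum-init-last; ∑-distrib-+)

  -- Order arithmetic and bounded search on the integers

  ≤-difference : ∀ {a b c d} → a ≤ b → b - a ≡ d - c → c ≤ d
  ≤-difference a≤b eq = 0≤i-j⇒j≤i (subst (0ℤ ≤_) eq (i≤j⇒0≤j-i a≤b))

  -- Together with `≤-difference` this reduces a linear inequality to a ring identity between
  -- differences, which `solve-∀` can check.
  <-difference : ∀ {a b c d} → a < b → b - a ≡ d - c → c < d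
  <-difference {a} {b} {c} {d} a<b eq = ≤∧≢⇒< (≤-difference (<⇒≤ a<b) eq) c≢d
    where
    c≢d : c ≢ d
    c≢d refl = <-irrefl (sym (i-j≡0⇒i≡j b a (trans eq (+-inverseʳ c)))) a<b

  i<i+1 : ∀ i → i < i + 1ℤ
  i<i+1 i = <-difference {0ℤ} {1ℤ} (+<+ (s≤s z≤n)) (eq i)
    where
    eq : ∀ i → 1ℤ - 0ℤ ≡ i + 1ℤ - i
    eq = solve-∀

  i-1<i : ∀ i → i - 1ℤ < i
  i-1<i i = <-difference {0ℤ} {1ℤ} (+<+ (s≤s z≤n)) (eq i)
    where
    eq : ∀ i → 1ℤ - 0ℤ ≡ i - (i - 1ℤ)
    eq = solve-∀

  i-1+1≡i : ∀ i → i - 1ℤ + 1ℤ ≡ i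
  i-1+1≡i = solve-∀

  i+1-1≡i : ∀ i → i + 1ℤ - 1ℤ ≡ i
  i+1-1≡i = solve-∀

  i+j-j≡i : ∀ i j → i + j - j ≡ i
  i+j-j≡i = solve-∀

  i-j+j≡i : ∀ i j → i - j + j ≡ i
  i-j+j≡i = solve-∀

  <⇒+1≤ : ∀ {i j} → i < j → i + 1ℤ ≤ j
  <⇒+1≤ {i} {j} i<j = subst (_≤ j) (+-comm 1ℤ i) (i<j⇒suc[i]≤j i<j)

  <⇒≤-1 : ∀ {i j} → i < j → i ≤ j - 1ℤ
  <⇒≤-1 {i} {j} i<j = ≤-difference (<⇒+1≤ i<j) (eq i j)
    where
    eq : ∀ i j → j - (i + 1ℤ) ≡ j - 1ℤ - i
    eq = solve-∀

  <+1⇒≤ : ∀ {i j} → i < j + 1ℤ → i ≤ j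
  <+1⇒≤ {i} {j} i<j+1 = subst (i ≤_) (i+1-1≡i j) (<⇒≤-1 i<j+1)

  -1<⇒≤ : ∀ {i j} → i - 1ℤ < j → i ≤ j
  -1<⇒≤ {i} {j} i-1<j = subst (_≤ j) (i-1+1≡i i) (<⇒+1≤ i-1<j)

  ≤⇒<+1 : ∀ {i j} → i ≤ j → i < j + 1ℤ
  ≤⇒<+1 {j = j} i≤j = ≤-<-trans i≤j (i<i+1 j)

  i≢i+1 : ∀ i → i ≢ i + 1ℤ
  i≢i+1 i eq = <-irrefl eq (i<i+1 i)

  i≢i-1 : ∀ i → i ≢ i - 1ℤ
  i≢i-1 i eq = <-irrefl (sym eq) (i-1<i i)

  ≮∧≢⇒> : ∀ {i j} → ¬ i < j → i ≢ j → j < i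
  ≮∧≢⇒> i≮j i≢j = ≤∧≢⇒< (≮⇒≥ i≮j) (i≢j ∘ sym)

  ≤⇒∃+ : ∀ {i j} → i ≤ j → ∃[ m ] j ≡ i + + m
  ≤⇒∃+ {i} {j} i≤j = ∣ j - i ∣ , (begin
    j                ≡⟨ eq i j ⟩
    i + (j - i)      ≡⟨ cong (λ k → i + k) (0≤i⇒+∣i∣≡i (i≤j⇒0≤j-i i≤j)) ⟨
    i + + ∣ j - i ∣  ∎)
    where
    open ≡-Reasoning
    eq : ∀ i j → j ≡ i + (j - i)
    eq = solve-∀

  i+1+m≡i+[1+m] : ∀ i m → i + 1ℤ + m ≡ i + (1ℤ + m)
  i+1+m≡i+[1+m] i m = +-assoc i 1ℤ m

  i+m+1≡i+[1+m] : ∀ i m → i + + m + 1ℤ ≡ i + + suc m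
  i+m+1≡i+[1+m] i m = eq i (+ m)
    where
    eq : ∀ i m → i + m + 1ℤ ≡ i + (1ℤ + m)
    eq = solve-∀

  least : ∀ {P : ℤ → Set} → (∀ i → Dec (P i)) → ∀ {l r} → l ≤ r → P r →
          ∃[ s ] l ≤ s × s ≤ r × P s × (∀ c → l ≤ c → c < s → ¬ P c)
  least {P} P? {l} l≤r Pr with ≤⇒∃+ l≤r
  ... | m , refl = go m l Pr
    where
    go : ∀ m l → P (l + + m) →
         ∃[ s ] l ≤ s × s ≤ l + + m × P s × (∀ c → l ≤ c → c < s → ¬ P c)
    go m l Pr with P? l
    ... | yes Pl = l , ≤-refl , i≤i+j l (+ m) , Pl ,
                   λ c l≤c c<l _ → <-irrefl refl (≤-<-trans l≤c c<l)
    go zero    l Pr | no ¬Pl = ⊥-elim (¬Pl (subst P (+-identityʳ l) Pr))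
    go (suc m) l Pr | no ¬Pl
      with s , l<s , s≤r , Ps , min ← go m (l + 1ℤ) (subst P (sym (i+1+m≡i+[1+m] l (+ m))) Pr) =
      s , ≤-trans (<⇒≤ (i<i+1 l)) l<s , subst (s ≤_) (i+1+m≡i+[1+m] l (+ m)) s≤r , Ps , min′
      where
      min′ : ∀ c → l ≤ c → c < s → ¬ P c
      min′ c l≤c c<s with l ≟ c
      ... | yes refl = ¬Pl
      ... | no  l≢c  = min c (<⇒+1≤ (≤∧≢⇒< l≤c l≢c)) c<s

  greatest : ∀ {P : ℤ → Set} → (∀ i → Dec (P i)) → ∀ {l r} → l ≤ r → P l →
             ∃[ s ] l ≤ s × s ≤ r × P s × (∀ c → s < c → c ≤ r → ¬ P c)
  greatest {P} P? {l} {r} l≤r Pl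
    with s , -r≤s , s≤-l , Ps , min ← least (P? ∘ -_) (neg-mono-≤ l≤r)
                                        (subst P (sym (neg-involutive l)) Pl) =
    - s , subst (_≤ - s) (neg-involutive l) (neg-mono-≤ s≤-l) ,
    subst (- s ≤_) (neg-involutive r) (neg-mono-≤ -r≤s) , Ps ,
    λ c -s<c c≤r Pc → min (- c) (neg-mono-≤ c≤r)
      (subst (- c <_) (neg-involutive s) (neg-mono-< -s<c)) (subst P (sym (neg-involutive c)) Pc)

  argmax : ∀ (f : ℤ → ℤ) {l r} → l ≤ r →
           ∃[ m ] l ≤ m × m ≤ r × (∀ c → l ≤ c → c ≤ r → f c ≤ f m)
  argmax f {l} l≤r with ≤⇒∃+ l≤r
  ... | k , refl = go k l
    where
    go : ∀ k l → ∃[ m ] l ≤ m × m ≤ l + + k × (∀ c → l ≤ c → c ≤ l + + k → f c ≤ f m)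
    go zero    l = l , ≤-refl , i≤i+j l 0ℤ , λ c l≤c c≤l →
      ≤-reflexive (cong f (≤-antisym (subst (c ≤_) (+-identityʳ l) c≤l) l≤c))
    go (suc k) l
      with m , l<m , m≤r , max ← go k (l + 1ℤ)
      rewrite i+1+m≡i+[1+m] l (+ k)
      with ≤-total (f l) (f m)
    ... | inj₁ fl≤fm = m , ≤-trans (<⇒≤ (i<i+1 l)) l<m , m≤r , max′
      where
      max′ : ∀ c → l ≤ c → c ≤ l + + suc k → f c ≤ f m
      max′ c l≤c c≤r with l ≟ c
      ... | yes refl = fl≤fm
      ... | no  l≢c  = max c (<⇒+1≤ (≤∧≢⇒< l≤c l≢c)) c≤r
    ... | inj₂ fm≤fl = l , ≤-refl , i≤i+j l (+ suc k) , max′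
      where
      max′ : ∀ c → l ≤ c → c ≤ l + + suc k → f c ≤ f l
      max′ c l≤c c≤r with l ≟ c
      ... | yes refl = ≤-refl
      ... | no  l≢c  = ≤-trans (max c (<⇒+1≤ (≤∧≢⇒< l≤c l≢c)) c≤r) fm≤fl

  module _ (n : ℕ) (2≤n : 2 ℕ.≤ n) where

    -- Sums over a window and the affine symmetric group

    instance
      n≢0 : ℕ.NonZero n
      n≢0 = ℕ.>-nonZero (ℕ.≤-trans (s≤s z≤n) 2≤n)

    N : ℤ
    N = + n

    0<N : 0ℤ < N
    0<N = +<+ (ℕ.≤-trans (s≤s z≤n) 2≤n)

    1<N : 1ℤ < N
    1<N = +<+ 2≤n

    instance
      N-positive : Positive N
      N-positive = positive 0<N

    i<i+N : ∀ i → i < i + N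
    i<i+N i = <-difference 0<N (eq i N)
      where
      eq : ∀ i N → N - 0ℤ ≡ i + N - i
      eq = solve-∀

    infix 4 _≋_
    -- The equation is solved for `x`, so that matching on `multiple k refl` replaces `x` by a
    -- translate of `y`.
    record _≋_ (x y : ℤ) : Set where
      constructor multiple
      field
        quotient : ℤ
        equation : x ≡ y + quotient * N

    ≋-refl : ∀ {x} → x ≋ x
    ≋-refl {x} = multiple 0ℤ (eq x N)
      where
      eq : ∀ x N → x ≡ x + 0ℤ * N
      eq = solve-∀

    ≋-reflexive : ∀ {x y} → x ≡ y → x ≋ y
    ≋-reflexive refl = ≋-refl

    ≋-sym : ∀ {x y} → x ≋ y → y ≋ x
    ≋-sym {x} {y} (multiple k refl) = multiple (- k) (eq y k N)
      where
      eq : ∀ y k N → y ≡ y + k * N + - k * N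
      eq = solve-∀

    ≋-trans : ∀ {x y z} → x ≋ y → y ≋ z → x ≋ z
    ≋-trans {z = z} (multiple k refl) (multiple l refl) = multiple (l + k) (eq z k l N)
      where
      eq : ∀ z k l N → z + l * N + k * N ≡ z + (l + k) * N
      eq = solve-∀

    ≋-+ : ∀ {x y} z → x ≋ y → x + z ≋ y + z
    ≋-+ {y = y} z (multiple k refl) = multiple k (eq y k z N)
      where
      eq : ∀ y k z N → y + k * N + z ≡ y + z + k * N
      eq = solve-∀

    ∣⇒≋ : ∀ {x y} → N ℤ∣.∣ x - y → x ≋ y
    ∣⇒≋ {x} {y} (ℤ∣.divides k x-y≡kN) = multiple k (trans (eq x y) (cong (λ z → y + z) x-y≡kN))
      where
      eq : ∀ x y → x ≡ y + (x - y)
      eq = solve-∀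

    ≋⇒∣ : ∀ {x y} → x ≋ y → N ℤ∣.∣ x - y
    ≋⇒∣ {y = y} (multiple k refl) = ℤ∣.divides k (eq y k N)
      where
      eq : ∀ y k N → y + k * N - y ≡ k * N
      eq = solve-∀

    infix 4 _≋?_
    _≋?_ : ∀ x y → Dec (x ≋ y)
    x ≋? y with N ℤ∣.∣? (x - y)
    ... | yes N∣x-y = yes (∣⇒≋ N∣x-y)
    ... | no  N∤x-y = no (N∤x-y ∘ ≋⇒∣)

    ≋∧close⇒≡ : ∀ {x y} → x ≋ y → y ≤ x → x < y + N → x ≡ y
    ≋∧close⇒≡ {y = y} (multiple k refl) y≤x x<y+N = trans (cong (λ k → y + k * N) k≡0) (eq₀ y N)
      where
      eq₀ : ∀ y N → y + 0ℤ * N ≡ y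
      eq₀ = solve-∀
      eq₁ : ∀ y k N → y + N - (y + k * N) ≡ 1ℤ * N - k * N
      eq₁ = solve-∀
      eq₂ : ∀ y k N → y + k * N - y ≡ k * N - 0ℤ * N
      eq₂ = solve-∀
      0≤k : 0ℤ ≤ k
      0≤k = *-cancelʳ-≤-pos 0ℤ k N (≤-difference y≤x (eq₂ y k N))
      k<1 : k < 1ℤ
      k<1 = *-cancelʳ-<-nonNeg N {{nonNegative (<⇒≤ 0<N)}} (<-difference x<y+N (eq₁ y k N))
      k≡0 : k ≡ 0ℤ
      k≡0 = ≤-antisym (<+1⇒≤ k<1) 0≤k

    i≢i+1-mod : ∀ {x y} → x ≋ y → ¬ x ≋ y + 1ℤ
    i≢i+1-mod {x} {y} x≋y x≋y+1 =
      i≢i+1 y (sym (≋∧close⇒≡ (≋-trans (≋-sym x≋y+1) x≋y) (<⇒≤ (i<i+1 y)) (+-monoʳ-< y 1<N)))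

    offset : ∀ x p → ∃[ d ] d ℕ.< n × x ≋ p + + d
    offset x p = r , n%ℕd<d (x - p) n , multiple q (trans (eq₁ x p) (trans (cong (λ z → p + z) (a≡a%ℕn+[a/ℕn]*n (x - p) n)) (eq₂ p (+ r) (q * N))))
      where
      r = (x - p) %ℕ n
      q = (x - p) /ℕ n
      eq₁ : ∀ x p → x ≡ p + (x - p)
      eq₁ = solve-∀
      eq₂ : ∀ p r z → p + (r + z) ≡ p + r + z
      eq₂ = solve-∀

    resid : ℤ → Fin n
    resid x = fromℕ< (proj₁ (proj₂ (offset x 1ℤ)))

    pos-resid : ∀ x → pos (resid x) ≋ x
    pos-resid x = ≋-trans (≋-reflexive (cong +[1+_] (Fin.toℕ-fromℕ< _)))
      (≋-sym (proj₂ (proj₂ (offset x 1ℤ))))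

    pos-injective : ∀ {i j : Fin n} → pos i ≋ pos j → i ≡ j
    pos-injective {i} {j} i≋j with ≤-total (pos j) (pos i)
    ... | inj₁ j≤i = Fin.toℕ-injective (ℕ.suc-injective (+-injective (≋∧close⇒≡ i≋j j≤i (bound j i))))
      where
      bound : ∀ (j i : Fin n) → pos i < pos j + N
      bound j i = ≤-<-trans (+≤+ (Fin.toℕ<n i)) (+<+ (ℕ.m<n+m n (s≤s z≤n)))
    ... | inj₂ i≤j = Fin.toℕ-injective (ℕ.suc-injective (+-injective (sym (≋∧close⇒≡ (≋-sym i≋j) i≤j (bound i j)))))
      where
      bound : ∀ (j i : Fin n) → pos i < pos j + N
      bound j i = ≤-<-trans (+≤+ (Fin.toℕ<n i)) (+<+ (ℕ.m<n+m n (s≤s z≤n)))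

    resid-cong : ∀ {x y} → x ≋ y → resid x ≡ resid y
    resid-cong {x} {y} x≋y = pos-injective (≋-trans (pos-resid x) (≋-trans x≋y (≋-sym (pos-resid y))))

    resid-pos : ∀ i → resid (pos i) ≡ i
    resid-pos i = pos-injective (pos-resid (pos i))

    Periodic : ∀ {a} {A : Set a} → (ℤ → A) → Set a
    Periodic g = ∀ x → g (x + N) ≡ g x

    Equivariant : (ℤ → ℤ) → Set
    Equivariant f = ∀ x → f (x + N) ≡ f x + N

    module _ {a} {A : Set a} (g : ℤ → A) (per : Periodic g) where

      periodic-multipleⁿ : ∀ m x → g (x + + m * N) ≡ g x
      periodic-multipleⁿ zero    x = cong g (eq x N)
        where
        eq : ∀ x N → x + 0ℤ * N ≡ x
        eq = solve-∀
      periodic-multipleⁿ (suc m) x = begin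
        g (x + + suc m * N)    ≡⟨ cong g (eq x (+ m) N) ⟩
        g (x + + m * N + N)    ≡⟨ per _ ⟩
        g (x + + m * N)        ≡⟨ periodic-multipleⁿ m x ⟩
        g x                    ∎
        where
        open ≡-Reasoning
        eq : ∀ x m N → x + (1ℤ + m) * N ≡ x + m * N + N
        eq = solve-∀

      periodic-multiple : ∀ k x → g (x + k * N) ≡ g x
      periodic-multiple (+ m)    x = periodic-multipleⁿ m x
      periodic-multiple -[1+ m ] x = begin
        g (x + - + suc m * N)                      ≡⟨ periodic-multipleⁿ (suc m) _ ⟨
        g (x + - + suc m * N + + suc m * N)        ≡⟨ cong g (eq x (+ suc m) N) ⟩
        g x                                        ∎
        where
        open ≡-Reasoning
        eq : ∀ x m N → x + - m * N + m * N ≡ x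
        eq = solve-∀

      periodic-≋ : ∀ {x y} → x ≋ y → g x ≡ g y
      periodic-≋ {y = y} (multiple k refl) = periodic-multiple k y

    displacement-periodic : ∀ f → Equivariant f → Periodic (λ x → f x - x)
    displacement-periodic f eqv x = trans (cong (λ z → z - (x + N)) (eqv x)) (eq (f x) x N)
      where
      eq : ∀ y x N → y + N - (x + N) ≡ y - x
      eq = solve-∀

    equivariant-multiple : ∀ f → Equivariant f → ∀ k x → f (x + k * N) ≡ f x + k * N
    equivariant-multiple f eqv k x = begin
      f (x + k * N)                              ≡⟨ eq₁ (f (x + k * N)) (x + k * N) ⟨
      f (x + k * N) - (x + k * N) + (x + k * N)  ≡⟨ cong (λ z → z + (x + k * N)) (periodic-multiple (λ x → f x - x) (displacement-periodic f eqv) k x) ⟩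
      f x - x + (x + k * N)                      ≡⟨ eq₂ (f x) x (k * N) ⟩
      f x + k * N                                ∎
      where
      open ≡-Reasoning
      eq₁ : ∀ y z → y - z + z ≡ y
      eq₁ = solve-∀
      eq₂ : ∀ y x z → y - x + (x + z) ≡ y + z
      eq₂ = solve-∀

    equivariant-≋ : ∀ f → Equivariant f → ∀ {x y} → x ≋ y → f x ≋ f y
    equivariant-≋ f eqv {y = y} (multiple k refl) = multiple k (equivariant-multiple f eqv k y)

    W : (ℤ → ℤ) → ℤ
    W g = sum {n} (g ∘ pos)

    W-cong : ∀ {g h} → g ≗ h → W g ≡ W h
    W-cong g≗h = sum-cong-≗ {n} (g≗h ∘ pos)

    W-+ : ∀ g h → W (λ x → g x + h x) ≡ W g + W h
    W-+ g h = ∑-distrib-+ {n} (g ∘ pos) (h ∘ pos)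

    W-neg : ∀ g → W (λ x → - g x) ≡ - W g
    W-neg g = go n (g ∘ pos)
      where
      go : ∀ m (t : Fin m → ℤ) → sum (λ i → - t i) ≡ - sum t
      go zero    t = refl
      go (suc m) t = trans (cong (λ z → - t Fin.zero + z) (go m (t ∘ Fin.suc)))
                           (sym (neg-distrib-+ (t Fin.zero) _))

    W-* : ∀ c g → W (λ x → g x * c) ≡ W g * c
    W-* c g = go n (g ∘ pos)
      where
      go : ∀ m (t : Fin m → ℤ) → sum (λ i → t i * c) ≡ sum t * c
      go zero    t = refl
      go (suc m) t = trans (cong (λ z → t Fin.zero * c + z) (go m (t ∘ Fin.suc)))
                           (sym (*-distribʳ-+ c (t Fin.zero) _))

    W-const : ∀ c → W (λ _ → c) ≡ N * c
    W-const c = go n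
      where
      eq : ∀ c m → c + m * c ≡ (1ℤ + m) * c
      eq = solve-∀
      go : ∀ m → sum {m} (λ _ → c) ≡ + m * c
      go zero    = refl
      go (suc m) = trans (cong (λ z → c + z) (go m)) (eq c (+ m))

    sum-mono-≤ : ∀ {m} {f g : Fin m → ℤ} → (∀ i → f i ≤ g i) → sum f ≤ sum g
    sum-mono-≤ {zero}  f≤g = ≤-refl
    sum-mono-≤ {suc m} f≤g = +-mono-≤ (f≤g Fin.zero) (sum-mono-≤ (f≤g ∘ Fin.suc))

    sum-mono-< : ∀ {m} {f g : Fin m → ℤ} → (∀ i → f i ≤ g i) → ∀ i → f i < g i → sum f < sum g
    sum-mono-< f≤g Fin.zero    fi<gi = +-mono-<-≤ fi<gi (sum-mono-≤ (f≤g ∘ Fin.suc))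
    sum-mono-< f≤g (Fin.suc i) fi<gi = +-mono-≤-< (f≤g Fin.zero) (sum-mono-< (f≤g ∘ Fin.suc) i fi<gi)

    -- An equivariant bijection permutes the residues modulo n, and a periodic `g` depends on
    -- residues only.
    W-reindex : ∀ (f f⁻¹ g : ℤ → ℤ) → f ∘ f⁻¹ ≗ id → f⁻¹ ∘ f ≗ id →
                Equivariant f → Equivariant f⁻¹ → Periodic g → W (g ∘ f) ≡ W g
    W-reindex f f⁻¹ g invˡ invʳ eqv eqv⁻¹ per = sym (begin
      sum {n} (g ∘ pos)                        ≡⟨ sum-permute {n} {n} (g ∘ pos) π ⟩
      sum {n} (λ i → g (pos (resid (f (pos i)))))  ≡⟨ sum-cong-≗ {n} (λ i → periodic-≋ g per (pos-resid (f (pos i)))) ⟩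
      sum {n} (g ∘ f ∘ pos)                    ∎)
      where
      open ≡-Reasoning
      cancel : ∀ h h⁻¹ → h ∘ h⁻¹ ≗ id → Equivariant h → ∀ i → resid (h (pos (resid (h⁻¹ (pos i))))) ≡ i
      cancel h h⁻¹ inv e i = trans
        (resid-cong (≋-trans (equivariant-≋ h e (pos-resid (h⁻¹ (pos i)))) (≋-reflexive (inv (pos i)))))
        (resid-pos i)
      π : Permutation n n
      π = permutation (resid ∘ f ∘ pos) (resid ∘ f⁻¹ ∘ pos) (cancel f f⁻¹ invˡ eqv) (cancel f⁻¹ f invʳ eqv⁻¹)

    W-shift : ∀ g c → Periodic g → W (λ x → g (x + c)) ≡ W g
    W-shift g c per = W-reindex (λ x → x + c) (λ x → x - c) g
      (λ x → i-j+j≡i x c) (λ x → i+j-j≡i x c) (λ x → eq x c N) (λ x → eq x (- c) N) per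
      where
      eq : ∀ x c N → x + N + c ≡ x + c + N
      eq = solve-∀

    AP : Set
    AP = AffinePermutation n

    module _ (w : AP) where
      open AffinePermutation w using (perm; periodic)

      to-from : ∀ x → to w (from w x) ≡ x
      to-from = Inverse.strictlyInverseˡ perm

      from-to : ∀ x → from w (to w x) ≡ x
      from-to = Inverse.strictlyInverseʳ perm

      from-equivariant : Equivariant (from w)
      from-equivariant x = begin
        from w (x + N)                ≡⟨ cong (λ y → from w (y + N)) (to-from x) ⟨
        from w (to w (from w x) + N)  ≡⟨ cong (from w) (periodic (from w x)) ⟨
        from w (to w (from w x + N))  ≡⟨ from-to _ ⟩
        from w x + N                  ∎
        where open ≡-Reasoning

      to-injective : ∀ {x y} → to w x ≡ to w y → x ≡ y
      to-injective {x} {y} eq = trans (sym (from-to x)) (trans (cong (from w) eq) (from-to y))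

      from-injective : ∀ {x y} → from w x ≡ from w y → x ≡ y
      from-injective {x} {y} eq = trans (sym (to-from x)) (trans (cong (to w) eq) (to-from y))

      to-+ : ∀ k x → to w (x + k * N) ≡ to w x + k * N
      to-+ = equivariant-multiple (to w) periodic

      from-+ : ∀ k x → from w (x + k * N) ≡ from w x + k * N
      from-+ = equivariant-multiple (from w) from-equivariant

      W-∘ : ∀ g → Periodic g → W (g ∘ to w) ≡ W g
      W-∘ g = W-reindex (to w) (from w) g to-from from-to periodic from-equivariant

      W-∘from : ∀ g → Periodic g → W (g ∘ from w) ≡ W g
      W-∘from g = W-reindex (from w) (to w) g from-to to-from from-equivariant periodic

    W-id : W id ≡ + (suc n ℕ.C 2)
    W-id = go n
      where
      open ≡-Reasoning
      go : ∀ m → sum {m} pos ≡ + (suc m ℕ.C 2)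
      go zero    = refl
      go (suc m) = begin
        sum {suc m} pos                                   ≡⟨ sum-init-last {m} pos ⟩
        sum {m} (pos ∘ inject₁) + pos (fromℕ m)           ≡⟨ cong₂ _+_ (sum-cong-≗ {m} (λ i → cong +[1+_] (Fin.toℕ-inject₁ i))) (cong +[1+_] (Fin.toℕ-fromℕ m)) ⟩
        sum {m} pos + + suc m                             ≡⟨ cong (λ z → z + + suc m) (go m) ⟩
        + (suc m ℕ.C 2 ℕ.+ suc m)                         ≡⟨ cong +_ (ℕ.+-comm (suc m ℕ.C 2) (suc m)) ⟩
        + (suc m ℕ.+ suc m ℕ.C 2)                         ≡⟨ cong (λ z → + (z ℕ.+ suc m ℕ.C 2)) (ℕ.nC1≡n (suc m)) ⟨
        + (suc m ℕ.C 1 ℕ.+ suc m ℕ.C 2)                   ≡⟨ cong +_ (ℕ.nCk+nC[k+1]≡[n+1]C[k+1] (suc m) 1) ⟩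
        + (suc (suc m) ℕ.C 2)                             ∎

    W-to : ∀ (w : AP) → W (to w) ≡ W id
    W-to w = trans (AffinePermutation.windowSum w) (sym W-id)

    W-displacement : ∀ (w : AP) → W (λ x → to w x - x) ≡ 0ℤ
    W-displacement w = begin
      W (λ x → to w x - x)          ≡⟨ W-+ (to w) (λ x → - x) ⟩
      W (to w) + W (λ x → - x)      ≡⟨ cong₂ _+_ (W-to w) (W-neg id) ⟩
      W id - W id                   ≡⟨ +-inverseʳ (W id) ⟩
      0ℤ                            ∎
      where open ≡-Reasoning

    -- The window sum is traded for total displacement 0. Displacement is periodic, so `W-reindex`
    -- applies to it and the condition passes to products and inverses.
    affine : (f f⁻¹ : ℤ → ℤ) → f ∘ f⁻¹ ≗ id → f⁻¹ ∘ f ≗ id → Equivariant f →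
             W (λ x → f x - x) ≡ 0ℤ → AP
    affine f f⁻¹ invˡ invʳ eqv W≡0 = record
      { perm      = mk↔ₛ′ f f⁻¹ invˡ invʳ
      ; periodic  = eqv
      ; windowSum = begin
          W f                             ≡⟨ W-cong (λ x → eq (f x) x) ⟩
          W (λ x → f x - x + x)           ≡⟨ W-+ (λ x → f x - x) id ⟩
          W (λ x → f x - x) + W id        ≡⟨ cong (λ z → z + W id) W≡0 ⟩
          0ℤ + W id                       ≡⟨ +-identityˡ (W id) ⟩
          W id                            ≡⟨ W-id ⟩
          + (suc n ℕ.C 2)                 ∎
      }
      where
      open ≡-Reasoning
      eq : ∀ y x → y ≡ y - x + x
      eq = solve-∀

    idᵃ : AP
    idᵃ = affine id id (λ _ → refl) (λ _ → refl) (λ _ → refl)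
      (trans (W-cong +-inverseʳ) (trans (W-const 0ℤ) (*-zeroʳ N)))

    infixr 9 _∘ᵃ_
    _∘ᵃ_ : AP → AP → AP
    v ∘ᵃ u = affine (to v ∘ to u) (from u ∘ from v)
      (λ x → trans (cong (to v) (to-from u (from v x))) (to-from v x))
      (λ x → trans (cong (from u) (from-to v (to u x))) (from-to u x))
      (λ x → trans (cong (to v) (AffinePermutation.periodic u x)) (AffinePermutation.periodic v (to u x)))
      (begin
        W (λ x → to v (to u x) - x)
          ≡⟨ W-cong (λ x → eq (to v (to u x)) (to u x) x) ⟩
        W (λ x → (to v (to u x) - to u x) + (to u x - x))
          ≡⟨ W-+ (λ x → to v (to u x) - to u x) (λ x → to u x - x) ⟩
        W (λ x → to v (to u x) - to u x) + W (λ x → to u x - x)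
          ≡⟨ cong₂ _+_ (trans (W-∘ u (λ x → to v x - x) (displacement-periodic (to v) (AffinePermutation.periodic v)))
                              (W-displacement v))
                       (W-displacement u) ⟩
        0ℤ ∎)
      where
      open ≡-Reasoning
      eq : ∀ a b c → a - c ≡ (a - b) + (b - c)
      eq = solve-∀

    infix 10 _⁻¹ᵃ
    _⁻¹ᵃ : AP → AP
    v ⁻¹ᵃ = affine (from v) (to v) (from-to v) (to-from v) (from-equivariant v) (begin
        W (λ x → from v x - x)
          ≡⟨ W-cong (λ x → trans (eq (from v x) x) (cong (λ z → - (z - from v x)) (sym (to-from v x)))) ⟩
        W (λ x → - (to v (from v x) - from v x))
          ≡⟨ W-neg (λ x → to v (from v x) - from v x) ⟩
        - W (λ x → to v (from v x) - from v x)
          ≡⟨ cong -_ (trans (W-∘from v (λ x → to v x - x) (displacement-periodic (to v) (AffinePermutation.periodic v)))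
                            (W-displacement v)) ⟩
        0ℤ ∎)
      where
      open ≡-Reasoning
      eq : ∀ a b → a - b ≡ - (b - a)
      eq = solve-∀

    -- The displacement `to f x - x` is weakly increasing and periodic, hence constant, and its sum
    -- over a window is 0.
    increasing⇒id : ∀ (f : AP) → (∀ {x y} → x < y → to f x < to f y) → ∀ x → to f x ≡ x
    increasing⇒id f mono x = i-j≡0⇒i≡j (to f x) x (c≡0 (g x) (begin
      N * g x               ≡⟨ W-const (g x) ⟨
      W (λ _ → g x)         ≡⟨ W-cong (λ y → ≤-antisym (g≤ x y) (g≤ y x)) ⟩
      W g                   ≡⟨ W-displacement f ⟩
      0ℤ                    ∎))
      where
      open ≡-Reasoning
      g : ℤ → ℤ
      g x = to f x - x
      g-periodic : Periodic g
      g-periodic = displacement-periodic (to f) (AffinePermutation.periodic f)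
      c≡0 : ∀ c → N * c ≡ 0ℤ → c ≡ 0ℤ
      c≡0 c Nc≡0 = case i*j≡0⇒i≡0∨j≡0 N Nc≡0 of λ where
        (inj₁ N≡0) → ⊥-elim (<-irrefl (sym N≡0) 0<N)
        (inj₂ c≡0) → c≡0
      g-step : ∀ x → g x ≤ g (x + 1ℤ)
      g-step x = ≤-difference (<⇒+1≤ (mono (i<i+1 x))) (eq (to f x) (to f (x + 1ℤ)) x)
        where
        eq : ∀ a b x → b - (a + 1ℤ) ≡ b - (x + 1ℤ) - (a - x)
        eq = solve-∀
      g-steps : ∀ m x → g x ≤ g (x + + m)
      g-steps zero    x = ≤-reflexive (cong g (sym (+-identityʳ x)))
      g-steps (suc m) x = ≤-trans (g-step x)
        (≤-trans (g-steps m (x + 1ℤ)) (≤-reflexive (cong g (i+1+m≡i+[1+m] x (+ m)))))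
      g≤ : ∀ x y → g x ≤ g y
      g≤ x y with d , _ , y≋x+d ← offset y x =
        ≤-trans (g-steps d x) (≤-reflexive (sym (periodic-≋ g g-periodic y≋x+d)))

    -- Reflections and words

    χ : ℤ → ℤ
    χ x = if does (N ℤ∣.∣? x) then 1ℤ else 0ℤ

    χ-yes : ∀ {x p} → x ≋ p → χ (x - p) ≡ 1ℤ
    χ-yes {x} {p} x≋p rewrite dec-true (N ℤ∣.∣? (x - p)) (≋⇒∣ x≋p) = refl

    χ-no : ∀ {x p} → ¬ x ≋ p → χ (x - p) ≡ 0ℤ
    χ-no {x} {p} x≋̸p rewrite dec-false (N ℤ∣.∣? (x - p)) (x≋̸p ∘ ∣⇒≋) = refl

    χ-nonneg : ∀ x → 0ℤ ≤ χ x
    χ-nonneg x with does (N ℤ∣.∣? x)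
    ... | true  = +≤+ z≤n
    ... | false = ≤-refl

    χ-periodic : Periodic χ
    χ-periodic x = case x ≋? 0ℤ of λ where
        (yes x≋0) → trans (via x+N-0 (χ-yes (≋-trans x+N≋x x≋0))) (sym (via x-0 (χ-yes x≋0)))
        (no x≋̸0) → trans (via x+N-0 (χ-no (x≋̸0 ∘ ≋-trans (≋-sym x+N≋x)))) (sym (via x-0 (χ-no x≋̸0)))
      where
      via : ∀ {y z c} → y ≡ z → χ y ≡ c → χ z ≡ c
      via refl eq = eq
      x-0 : x - 0ℤ ≡ x
      x-0 = +-identityʳ x
      x+N-0 : x + N - 0ℤ ≡ x + N
      x+N-0 = +-identityʳ (x + N)
      x+N≋x : x + N ≋ x
      x+N≋x = multiple 1ℤ (cong (λ z → x + z) (sym (*-identityˡ N)))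

    W-χ : ∀ p → W (λ x → χ (x - p)) ≡ W χ
    W-χ p = W-shift χ (- p) χ-periodic

    0<W-χ : 0ℤ < W χ
    0<W-χ = subst (_< W χ) (trans (W-const 0ℤ) (*-zeroʳ N))
      (sum-mono-< {n} (χ-nonneg ∘ pos) (resid 0ℤ) (subst (0ℤ <_) (sym χ≡1) (+<+ (s≤s z≤n))))
      where
      χ≡1 : χ (pos (resid 0ℤ)) ≡ 1ℤ
      χ≡1 = trans (cong χ (sym (+-identityʳ (pos (resid 0ℤ))))) (χ-yes {pos (resid 0ℤ)} {0ℤ} (pos-resid 0ℤ))

    -- The reflection exchanging p + kn and q + kn for all k, in the same form as `generator` with
    -- `q - p` in place of 1.
    swap : ℤ → ℤ → ℤ → ℤ
    swap p q x =
      if does (N ℤ∣.∣? (x - p)) then x + (q - p) else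
      if does (N ℤ∣.∣? (x - q)) then x - (q - p) else x

    data Swap (p q x : ℤ) : ℤ → Set where
      left  : x ≋ p → Swap p q x (x + (q - p))
      right : x ≋ q → Swap p q x (x - (q - p))
      fixed : ¬ x ≋ p → ¬ x ≋ q → Swap p q x x

    swap-view : ∀ p q x → Swap p q x (swap p q x)
    swap-view p q x = go (N ℤ∣.∣? (x - p)) (N ℤ∣.∣? (x - q))
      where
      go : (p? : Dec (N ℤ∣.∣ x - p)) (q? : Dec (N ℤ∣.∣ x - q)) →
           Swap p q x (if does p? then x + (q - p) else if does q? then x - (q - p) else x)
      go (yes N∣x-p) _           = left (∣⇒≋ N∣x-p)
      go (no N∤x-p)  (yes N∣x-q) = right (∣⇒≋ N∣x-q)
      go (no N∤x-p)  (no N∤x-q)  = fixed (N∤x-p ∘ ≋⇒∣) (N∤x-q ∘ ≋⇒∣)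

    swap-unique : ∀ {p q} → ¬ p ≋ q → ∀ {x y} → Swap p q x y → swap p q x ≡ y
    swap-unique {p} {q} p≋̸q {x} view = go (swap-view p q x) view
      where
      go : ∀ {y z} → Swap p q x y → Swap p q x z → y ≡ z
      go (left _)        (left _)        = refl
      go (left x≋p)      (right x≋q)     = ⊥-elim (p≋̸q (≋-trans (≋-sym x≋p) x≋q))
      go (left x≋p)      (fixed x≋̸p _)   = ⊥-elim (x≋̸p x≋p)
      go (right x≋q)     (left x≋p)      = ⊥-elim (p≋̸q (≋-trans (≋-sym x≋p) x≋q))
      go (right _)       (right _)       = refl
      go (right x≋q)     (fixed _ x≋̸q)   = ⊥-elim (x≋̸q x≋q)
      go (fixed x≋̸p _)   (left x≋p)      = ⊥-elim (x≋̸p x≋p)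
      go (fixed _ x≋̸q)   (right x≋q)     = ⊥-elim (x≋̸q x≋q)
      go (fixed _ _)     (fixed _ _)     = refl

    swap-resp : ∀ {p q x y z} → y ≡ z → Swap p q x y → Swap p q x z
    swap-resp refl v = v

    swap-sym : ∀ {p q} → ¬ p ≋ q → ∀ x → swap p q x ≡ swap q p x
    swap-sym {p} {q} p≋̸q x = swap-unique p≋̸q (flip (swap-view q p x))
      where
      eq₁ : ∀ x p q → x + (p - q) ≡ x - (q - p)
      eq₁ = solve-∀
      eq₂ : ∀ x p q → x - (p - q) ≡ x + (q - p)
      eq₂ = solve-∀
      flip : ∀ {y} → Swap q p x y → Swap p q x y
      flip (left x≋q)      = swap-resp (sym (eq₁ x p q)) (right x≋q)
      flip (right x≋p)     = swap-resp (sym (eq₂ x p q)) (left x≋p)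
      flip (fixed x≋̸q x≋̸p) = fixed x≋̸p x≋̸q

    swap-involutive : ∀ {p q} → ¬ p ≋ q → ∀ x → swap p q (swap p q x) ≡ x
    swap-involutive {p} {q} p≋̸q x = go (swap-view p q x)
      where
      eq₁ : ∀ x p q → x + (q - p) - (q - p) ≡ x
      eq₁ = solve-∀
      eq₂ : ∀ x p q → x - (q - p) + (q - p) ≡ x
      eq₂ = solve-∀
      eq₃ : ∀ p q → p + (q - p) ≡ q
      eq₃ = solve-∀
      eq₄ : ∀ p q → q - (q - p) ≡ p
      eq₄ = solve-∀
      go : ∀ {y} → Swap p q x y → swap p q y ≡ x
      go (left x≋p)      = swap-unique p≋̸q (swap-resp (eq₁ x p q)
        (right (subst (x + (q - p) ≋_) (eq₃ p q) (≋-+ (q - p) x≋p))))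
      go (right x≋q)     = swap-unique p≋̸q (swap-resp (eq₂ x p q)
        (left (subst (x - (q - p) ≋_) (eq₄ p q) (≋-+ (- (q - p)) x≋q))))
      go (fixed x≋̸p x≋̸q) = swap-unique p≋̸q (fixed x≋̸p x≋̸q)

    equivariant-reflects-≋ : ∀ f → Equivariant f → (∀ {x y} → f x ≡ f y → x ≡ y) →
                             ∀ {x y} → f x ≋ f y → x ≋ y
    equivariant-reflects-≋ f eqv inj {x} {y} (multiple k eq) =
      multiple k (inj (trans eq (sym (equivariant-multiple f eqv k y))))

    swap-conjugate : ∀ f → Equivariant f → (∀ {x y} → f x ≡ f y → x ≡ y) →
                     ∀ {p q} → ¬ p ≋ q → ∀ x → swap (f p) (f q) (f x) ≡ f (swap p q x)
    swap-conjugate f eqv inj {p} {q} p≋̸q x =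
      swap-unique (p≋̸q ∘ reflects) (go (swap-view p q x))
      where
      reflects : ∀ {x y} → f x ≋ f y → x ≋ y
      reflects = equivariant-reflects-≋ f eqv inj
      eq₁ : ∀ p q z → p + z + (q - p) ≡ q + z
      eq₁ = solve-∀
      eq₂ : ∀ p q z → q + z - (q - p) ≡ p + z
      eq₂ = solve-∀
      go : ∀ {y} → Swap p q x y → Swap (f p) (f q) (f x) (f y)
      go (left x≋p@(multiple k refl)) = swap-resp (begin
        f (p + k * N) + (f q - f p)  ≡⟨ cong (λ z → z + (f q - f p)) (equivariant-multiple f eqv k p) ⟩
        f p + k * N + (f q - f p)    ≡⟨ eq₁ (f p) (f q) (k * N) ⟩
        f q + k * N                  ≡⟨ equivariant-multiple f eqv k q ⟨
        f (q + k * N)                ≡⟨ cong f (eq₁ p q (k * N)) ⟨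
        f (p + k * N + (q - p))      ∎) (left (equivariant-≋ f eqv x≋p))
        where open ≡-Reasoning
      go (right x≋q@(multiple k refl)) = swap-resp (begin
        f (q + k * N) - (f q - f p)  ≡⟨ cong (λ z → z - (f q - f p)) (equivariant-multiple f eqv k q) ⟩
        f q + k * N - (f q - f p)    ≡⟨ eq₂ (f p) (f q) (k * N) ⟩
        f p + k * N                  ≡⟨ equivariant-multiple f eqv k p ⟨
        f (p + k * N)                ≡⟨ cong f (eq₂ p q (k * N)) ⟨
        f (q + k * N - (q - p))      ∎) (right (equivariant-≋ f eqv x≋q))
        where open ≡-Reasoning
      go (fixed x≋̸p x≋̸q) = fixed (x≋̸p ∘ reflects) (x≋̸q ∘ reflects)

    swap-equivariant : ∀ {p q} → ¬ p ≋ q → Equivariant (swap p q)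
    swap-equivariant {p} {q} p≋̸q x = swap-unique p≋̸q (go (swap-view p q x))
      where
      x+N≋x : x + N ≋ x
      x+N≋x = multiple 1ℤ (cong (λ z → x + z) (sym (*-identityˡ N)))
      eq : ∀ x N d → x + N + d ≡ x + d + N
      eq = solve-∀
      go : ∀ {y} → Swap p q x y → Swap p q (x + N) (y + N)
      go (left x≋p)      = swap-resp (eq x N (q - p)) (left (≋-trans x+N≋x x≋p))
      go (right x≋q)     = swap-resp (eq x N (- (q - p))) (right (≋-trans x+N≋x x≋q))
      go (fixed x≋̸p x≋̸q) = fixed (x≋̸p ∘ ≋-trans (≋-sym x+N≋x)) (x≋̸q ∘ ≋-trans (≋-sym x+N≋x))

    -- The two indicator terms have equal window sums, so in this form the displacement of a
    -- reflection visibly cancels.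
    swap-displacement : ∀ {p q} → ¬ p ≋ q → ∀ x →
                        swap p q x ≡ x + (χ (x - p) * (q - p) + - (χ (x - q) * (q - p)))
    swap-displacement {p} {q} p≋̸q x = go (swap-view p q x)
      where
      eq₁ : ∀ x d → x + d ≡ x + (1ℤ * d + - (0ℤ * d))
      eq₁ = solve-∀
      eq₂ : ∀ x d → x - d ≡ x + (0ℤ * d + - (1ℤ * d))
      eq₂ = solve-∀
      eq₃ : ∀ x d → x ≡ x + (0ℤ * d + - (0ℤ * d))
      eq₃ = solve-∀
      go : ∀ {y} → Swap p q x y → y ≡ x + (χ (x - p) * (q - p) + - (χ (x - q) * (q - p)))
      go (left x≋p) rewrite χ-yes x≋p | χ-no {x} {q} (p≋̸q ∘ ≋-trans (≋-sym x≋p)) = eq₁ x (q - p)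
      go (right x≋q) rewrite χ-yes x≋q | χ-no {x} {p} (λ x≋p → p≋̸q (≋-trans (≋-sym x≋p) x≋q)) = eq₂ x (q - p)
      go (fixed x≋̸p x≋̸q) rewrite χ-no x≋̸p | χ-no x≋̸q = eq₃ x (q - p)

    swapᵃ : ∀ p q → ¬ p ≋ q → AP
    swapᵃ p q p≋̸q = affine (swap p q) (swap p q) (swap-involutive p≋̸q) (swap-involutive p≋̸q)
      (swap-equivariant p≋̸q) (begin
        W (λ x → swap p q x - x)
          ≡⟨ W-cong (λ x → trans (cong (λ z → z - x) (swap-displacement p≋̸q x)) (eq x _)) ⟩
        W (λ x → χ (x - p) * (q - p) + - (χ (x - q) * (q - p)))
          ≡⟨ W-+ (λ x → χ (x - p) * (q - p)) (λ x → - (χ (x - q) * (q - p))) ⟩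
        W (λ x → χ (x - p) * (q - p)) + W (λ x → - (χ (x - q) * (q - p)))
          ≡⟨ cong₂ _+_ (W-χ* p) (trans (W-neg (λ x → χ (x - q) * (q - p))) (cong -_ (W-χ* q))) ⟩
        W χ * (q - p) - W χ * (q - p)
          ≡⟨ +-inverseʳ (W χ * (q - p)) ⟩
        0ℤ ∎)
      where
      open ≡-Reasoning
      eq : ∀ x d → x + d - x ≡ d
      eq = solve-∀
      W-χ* : ∀ r → W (λ x → χ (x - r) * (q - p)) ≡ W χ * (q - p)
      W-χ* r = trans (W-* (q - p) (λ x → χ (x - r))) (cong (λ z → z * (q - p)) (W-χ r))

    i≋̸i+1 : ∀ {i} → ¬ i ≋ i + 1ℤ
    i≋̸i+1 = i≢i+1-mod ≋-refl

    adj : ℤ → ℤ → ℤ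
    adj a = swap a (a + 1ℤ)

    adjᵃ : ℤ → AP
    adjᵃ a = swapᵃ a (a + 1ℤ) i≋̸i+1

    adj-involutive : ∀ a x → adj a (adj a x) ≡ x
    adj-involutive a = swap-involutive i≋̸i+1

    a+1-a≡1 : ∀ a → a + 1ℤ - a ≡ 1ℤ
    a+1-a≡1 = solve-∀

    data Adj (a x : ℤ) : ℤ → Set where
      up    : x ≋ a → Adj a x (x + 1ℤ)
      down  : x ≋ a + 1ℤ → Adj a x (x - 1ℤ)
      fixed : ¬ x ≋ a → ¬ x ≋ a + 1ℤ → Adj a x x

    adj-view : ∀ a x → Adj a x (adj a x)
    adj-view a x = go (swap-view a (a + 1ℤ) x)
      where
      go : ∀ {y} → Swap a (a + 1ℤ) x y → Adj a x y
      go (left x≋a)       = subst (Adj a x) (cong (λ z → x + z) (sym (a+1-a≡1 a))) (up x≋a)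
      go (right x≋a+1)    = subst (Adj a x) (cong (λ z → x - z) (sym (a+1-a≡1 a))) (down x≋a+1)
      go (fixed x≋̸a x≋̸a+1) = fixed x≋̸a x≋̸a+1

    adj-unique : ∀ {a x y} → Adj a x y → adj a x ≡ y
    adj-unique {a} {x} v = swap-unique i≋̸i+1 (go v)
      where
      go : ∀ {y} → Adj a x y → Swap a (a + 1ℤ) x y
      go (up x≋a)         = swap-resp (cong (λ z → x + z) (a+1-a≡1 a)) (left x≋a)
      go (down x≋a+1)     = swap-resp (cong (λ z → x - z) (a+1-a≡1 a)) (right x≋a+1)
      go (fixed x≋̸a x≋̸a+1) = fixed x≋̸a x≋̸a+1

    adj-cong : ∀ {a b} → a ≋ b → ∀ x → adj a x ≡ adj b x
    adj-cong {a} {b} a≋b x = adj-unique (go (adj-view b x))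
      where
      go : ∀ {y} → Adj b x y → Adj a x y
      go (up x≋b)         = up (≋-trans x≋b (≋-sym a≋b))
      go (down x≋b+1)     = down (≋-trans x≋b+1 (≋-+ 1ℤ (≋-sym a≋b)))
      go (fixed x≋̸b x≋̸b+1) = fixed (λ x≋a → x≋̸b (≋-trans x≋a a≋b))
                                    (λ x≋a+1 → x≋̸b+1 (≋-trans x≋a+1 (≋-+ 1ℤ a≋b)))

    generator≗adj : ∀ i → generator {n} i ≗ adj (pos i)
    generator≗adj i x = cong
      (λ d → if does (N ℤ∣.∣? (x - pos i)) then x + d else
             if does (N ℤ∣.∣? (x - (pos i + 1ℤ))) then x - d else x)
      (sym (a+1-a≡1 (pos i)))

    generator-resid : ∀ a x → generator (resid a) x ≡ adj a x
    generator-resid a x = trans (generator≗adj (resid a) x) (adj-cong (pos-resid a) x)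

    adj-inverts : ∀ {a x y} → x < y → adj a y < adj a x → x ≋ a × y ≡ x + 1ℤ
    adj-inverts {a} {x} {y} x<y = go (adj-view a x) (adj-view a y)
      where
      go : ∀ {x′ y′} → Adj a x x′ → Adj a y y′ → y′ < x′ → x ≋ a × y ≡ x + 1ℤ
      go (up x≋a)    (up _)      lt = ⊥-elim (<-asym x<y (<-difference lt (eq x y)))
        where
        eq : ∀ x y → x + 1ℤ - (y + 1ℤ) ≡ x - y
        eq = solve-∀
      go (up x≋a)    (down _)    lt = x≋a , ≤-antisym (-1<⇒≤ lt) (<⇒+1≤ x<y)
      go (up x≋a)    (fixed _ _) lt = ⊥-elim (<⇒≱ x<y (<+1⇒≤ lt))
      go (down _)    (up _)      lt = ⊥-elim (<-asym x<y (<-trans (<-trans (i<i+1 y) lt) (i-1<i x)))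
      go (down _)    (down _)    lt = ⊥-elim (<-asym x<y (<-difference lt (eq x y)))
        where
        eq : ∀ x y → x - 1ℤ - (y - 1ℤ) ≡ x - y
        eq = solve-∀
      go (down _)    (fixed _ _) lt = ⊥-elim (<-asym x<y (<-trans lt (i-1<i x)))
      go (fixed _ _) (up _)      lt = ⊥-elim (<-asym x<y (<-trans (i<i+1 y) lt))
      go (fixed _ _) (down _)    lt = ⊥-elim (<⇒≱ x<y (-1<⇒≤ lt))
      go (fixed _ _) (fixed _ _) lt = ⊥-elim (<-asym x<y lt)

    wp : List (Fin n) → ℤ → ℤ
    wp = wordProduct {n}

    wp-equivariant : ∀ is → Equivariant (wp is)
    wp-equivariant []       x = refl
    wp-equivariant (i ∷ is) x = begin
      generator i (wp is (x + N))    ≡⟨ cong (generator i) (wp-equivariant is x) ⟩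
      generator i (wp is x + N)      ≡⟨ generator≗adj i _ ⟩
      adj (pos i) (wp is x + N)      ≡⟨ swap-equivariant i≋̸i+1 (wp is x) ⟩
      adj (pos i) (wp is x) + N      ≡⟨ cong (λ z → z + N) (generator≗adj i _) ⟨
      generator i (wp is x) + N      ∎
      where open ≡-Reasoning

    generator-involutive : ∀ i x → generator {n} i (generator i x) ≡ x
    generator-involutive i x = trans (generator≗adj i _)
      (trans (cong (adj (pos i)) (generator≗adj i x)) (adj-involutive (pos i) x))

    wp-injective : ∀ is {x y} → wp is x ≡ wp is y → x ≡ y
    wp-injective []       eq = eq
    wp-injective (i ∷ is) {x} {y} eq = wp-injective is (begin
      wp is x                              ≡⟨ generator-involutive i _ ⟨
      generator i (generator i (wp is x))  ≡⟨ cong (generator i) eq ⟩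
      generator i (generator i (wp is y))  ≡⟨ generator-involutive i _ ⟩
      wp is y                              ∎)
      where open ≡-Reasoning

    wp-++ : ∀ is js x → wp (is ++ js) x ≡ wp is (wp js x)
    wp-++ is js x = List.foldr-++ generator x is js

    -- Congruent positions keep their difference under an equivariant map.
    inversion⇒≋̸ : ∀ f → Equivariant f → ∀ {p q} → p < q → f q < f p → ¬ p ≋ q
    inversion⇒≋̸ f eqv {p} {q} p<q fq<fp (multiple k refl) =
      <-asym p<q (<-difference fq<fp (trans (cong (λ z → z - f q) (equivariant-multiple f eqv k q)) (eq (f q) q (k * N))))
      where
      eq : ∀ y q z → y + z - y ≡ q + z - q
      eq = solve-∀

    -- The exchange condition: along the word some letter inverts the pair p < q,
    -- and omitting that letter multiplies the product by the reflection.
    exchange : ∀ is {p q} → p < q → wp is q < wp is p →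
               ∃[ js ] suc (length js) ≡ length is × (∀ x → wp js x ≡ wp is (swap p q x))
    exchange []       p<q q<p = ⊥-elim (<-asym p<q q<p)
    exchange (i ∷ is) {p} {q} p<q inv with <-cmp (wp is p) (wp is q)
    ... | tri> _ _ inv′ with js , len , eq ← exchange is p<q inv′ =
      i ∷ js , cong suc len , λ x → cong (generator i) (eq x)
    ... | tri≈ _ eq _ = ⊥-elim (<-irrefl (wp-injective is eq) p<q)
    ... | tri< lt _ _
      with p≋i , q≡p+1 ← adj-inverts lt (subst₂ _<_ (generator≗adj i _) (generator≗adj i _) inv) =
      -- The letter `i` exchanges the neighbouring images of p and q. Carried through the rest of
      -- the word, the reflection becomes this letter, and the two cancel.
      is , refl , λ x → sym (begin
        generator i (wp is (swap p q x))                         ≡⟨ cong (generator i) (swap-conjugate (wp is) (wp-equivariant is) (wp-injective is) p≋̸q x) ⟨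
        generator i (swap (wp is p) (wp is q) (wp is x))         ≡⟨ cong (λ z → generator i (swap (wp is p) z (wp is x))) q≡p+1 ⟩
        generator i (adj (wp is p) (wp is x))                    ≡⟨ cong (generator i) (adj-cong p≋i (wp is x)) ⟩
        generator i (adj (pos i) (wp is x))                      ≡⟨ cong (generator i) (generator≗adj i (wp is x)) ⟨
        generator i (generator i (wp is x))                      ≡⟨ generator-involutive i (wp is x) ⟩
        wp is x                                                  ∎)
      where
      open ≡-Reasoning
      p≋̸q : ¬ p ≋ q
      p≋̸q = inversion⇒≋̸ (wp (i ∷ is)) (wp-equivariant (i ∷ is)) p<q inv

    -- If `u` did not invert the pair, a minimal word for `v` would invert it and the word for the
    -- quotient would undo this. Exchange then shortens both words, and their concatenation is a
    -- word for `u` below its length.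
    ≤L⇒inversions : ∀ {v u : AP} → v ≤L u → ∀ {p q} → p < q → to v q < to v p → to u q < to u p
    ≤L⇒inversions {v} {u} (a , b , c , ((zs , zs≗ , refl) , _) , (_ , min) , ((vs , vs≗ , refl) , _) , a≡b-c)
      {p} {q} p<q invᵥ with <-cmp (to u q) (to u p)
    ... | tri< inv _ _ = inv
    ... | tri≈ _ eq _ = ⊥-elim (<-irrefl (sym (to-injective u eq)) p<q)
    ... | tri> _ _ noninv = ⊥-elim (ℕ.<-irrefl refl shorter)
      where
      invᵥ′ : wp vs q < wp vs p
      invᵥ′ = subst₂ _<_ (sym (vs≗ q)) (sym (vs≗ p)) invᵥ
      zsvs : ∀ x → wp zs (wp vs x) ≡ to u x
      zsvs x = trans (cong (wp zs) (vs≗ x)) (trans (zs≗ (to v x)) (cong (to u) (from-to v x)))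
      p≋̸q : ¬ p ≋ q
      p≋̸q = inversion⇒≋̸ (wp vs) (wp-equivariant vs) p<q invᵥ′
      vp≋̸vq : ¬ wp vs p ≋ wp vs q
      vp≋̸vq = p≋̸q ∘ equivariant-reflects-≋ (wp vs) (wp-equivariant vs) (wp-injective vs)
      exᵥ = exchange vs p<q invᵥ′
      vs′ = proj₁ exᵥ
      eqᵥ = proj₂ (proj₂ exᵥ)
      exᵤ = exchange zs invᵥ′ (subst₂ _<_ (sym (zsvs p)) (sym (zsvs q)) noninv)
      zs′ = proj₁ exᵤ
      eqᵤ = proj₂ (proj₂ exᵤ)
      -- Conjugation by `wp vs` turns the reflection gained from `zs` into the one gained from `vs`,
      -- and the two cancel.
      product : wp (zs′ ++ vs′) ≗ to u
      product x = begin
        wp (zs′ ++ vs′) x                                                ≡⟨ wp-++ zs′ vs′ x ⟩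
        wp zs′ (wp vs′ x)                                                ≡⟨ eqᵤ _ ⟩
        wp zs (swap (wp vs q) (wp vs p) (wp vs′ x))                      ≡⟨ cong (wp zs ∘ swap (wp vs q) (wp vs p)) (eqᵥ x) ⟩
        wp zs (swap (wp vs q) (wp vs p) (wp vs (swap p q x)))            ≡⟨ cong (wp zs) (swap-sym vp≋̸vq _) ⟨
        wp zs (swap (wp vs p) (wp vs q) (wp vs (swap p q x)))            ≡⟨ cong (wp zs) (swap-conjugate (wp vs) (wp-equivariant vs) (wp-injective vs) p≋̸q _) ⟩
        wp zs (wp vs (swap p q (swap p q x)))                            ≡⟨ cong (wp zs ∘ wp vs) (swap-involutive p≋̸q x) ⟩
        wp zs (wp vs x)                                                  ≡⟨ zsvs x ⟩
        to u x                                                           ∎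
        where open ≡-Reasoning
      b≡a+c : b ≡ length zs ℕ.+ length vs
      b≡a+c = +-injective (trans (sym (i-j+j≡i (+ b) (+ length vs))) (cong (λ z → z + + length vs) (sym a≡b-c)))
      shorter : b ℕ.< b
      shorter = begin-strict
        b                                ≤⟨ min (zs′ ++ vs′) product ⟩
        length (zs′ ++ vs′)              ≡⟨ List.length-++ zs′ ⟩
        length zs′ ℕ.+ length vs′        <⟨ ℕ.+-mono-< (ℕ.≤-reflexive (proj₁ (proj₂ exᵤ))) (ℕ.≤-reflexive (proj₁ (proj₂ exᵥ))) ⟩
        length zs ℕ.+ length vs          ≡⟨ b≡a+c ⟨
        b                                ∎
        where open ℕ.≤-Reasoning

    -- Coxeter length

    -- If no word were shortest, strong induction on the length would exclude every word.
    word⇒¬¬length : ∀ f is → wp is ≗ f → ¬ ¬ (∃[ k ] HasLength n f k)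
    word⇒¬¬length f is eq noLength = none (length is) is refl eq
      where
      none : ∀ k js → length js ≡ k → ¬ wp js ≗ f
      none = ℕ.<-rec _ λ k below js len eq → noLength (k , (js , eq , len) , λ is′ eq′ →
        ℕ.≮⇒≥ λ shorter → below shorter is′ refl eq′)

    -- Whether u has a length is undecided here, hence the double negation.
    adj≤L : ∀ (u : AP) a is → wp is ≗ to u → from u (a + 1ℤ) < from u a →
            ¬ ¬ (adjᵃ a ∘ᵃ u ≤L u)
    adj≤L u a is is≗ inv not≤ =
      word⇒¬¬length (to u) is is≗ λ (b , hu@((us , us≗ , lenᵤ) , minᵤ)) →
      word⇒¬¬length (adj a ∘ to u) (resid a ∷ is) (λ x → trans (generator-resid a _) (cong (adj a) (is≗ x)))
      λ (c , hv@((vs , vs≗ , lenᵥ) , minᵥ)) →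
      let us′ , lenᵤ′ , us′≗ = exchange us inv (subst₂ _<_
            (sym (trans (us≗ (from u a)) (to-from u a))) (sym (trans (us≗ (from u (a + 1ℤ))) (to-from u (a + 1ℤ))))
            (i<i+1 a))
          -- Deleting a letter from a minimal word of `u` gives `c < b`; putting the generator
          -- before a minimal word of the product gives `b ≤ 1 + c`. Hence the lengths differ by
          -- exactly 1, the length of the quotient.
          c<b : c ℕ.< b
          c<b = subst (c ℕ.<_) (trans lenᵤ′ lenᵤ)
                  (s≤s (minᵥ us′ λ x → trans (us′≗ x) (trans (us≗ _) (sym (conjugate x)))))
          b≤1+c : b ℕ.≤ suc c
          b≤1+c = subst (λ l → b ℕ.≤ suc l) lenᵥ
                    (minᵤ (resid a ∷ vs) λ x → trans (generator-resid a _)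
                      (trans (cong (adj a) (vs≗ x)) (adj-involutive a (to u x))))
      in not≤ (1 , b , c ,
          ((resid a ∷ [] , (λ x → trans (generator-resid a x) (sym (to-from u (adj a x)))) , refl) , nonempty) ,
          hu , hv , trans (sym (i+j-j≡i 1ℤ (+ c))) (cong (λ l → + l - + c) (ℕ.≤-antisym c<b b≤1+c)))
      where
      p q : ℤ
      p = from u (a + 1ℤ)
      q = from u a
      p≋̸q : ¬ p ≋ q
      p≋̸q p≋q = i≋̸i+1 (≋-sym (equivariant-reflects-≋ (from u) (from-equivariant u) (from-injective u) p≋q))
      conjugate : ∀ x → adj a (to u x) ≡ to u (swap p q x)
      conjugate x = begin
        swap a (a + 1ℤ) (to u x)            ≡⟨ swap-sym i≋̸i+1 _ ⟩
        swap (a + 1ℤ) a (to u x)            ≡⟨ cong₂ (λ y z → swap y z (to u x)) (to-from u (a + 1ℤ)) (to-from u a) ⟨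
        swap (to u p) (to u q) (to u x)     ≡⟨ swap-conjugate (to u) (AffinePermutation.periodic u) (to-injective u) p≋̸q x ⟩
        to u (swap p q x)                   ∎
        where open ≡-Reasoning
      nonempty : ∀ js → wp js ≗ (to u ∘ from (adjᵃ a ∘ᵃ u)) → 1 ℕ.≤ length js
      nonempty (j ∷ js) _  = s≤s z≤n
      nonempty []       eq = ⊥-elim (i≢i+1 a (trans (eq a) (trans (to-from u (adj a a)) (adj-unique (up ≋-refl)))))

    -- Every affine permutation is a product of generators

    square-nonneg : ∀ i → 0ℤ ≤ i * i
    square-nonneg (+ m)    = subst (0ℤ ≤_) (pos-* m m) (+≤+ z≤n)
    square-nonneg -[1+ m ] = +≤+ z≤n

    deviation : AP → ℤ → ℤ
    deviation w y = (y - from w y) * (y - from w y)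

    -- Multiplying by an adjacent transposition that removes an inversion lowers
    -- the sum of (w(x) − x)² over a window; reindexing by y = w(x) lets the
    -- transposition act on the summation index.
    adj-deviation : ∀ (w : AP) a → from w (a + 1ℤ) < from w a → W (deviation (adjᵃ a ∘ᵃ w)) < W (deviation w)
    adj-deviation w a inv = <-difference {W χ * (A + B)} {0ℤ} negative-change (begin
      0ℤ - W χ * (A + B)                                                         ≡⟨ eq₀ (W (deviation w)) (W χ) A B ⟩
      W (deviation w) - (W (deviation w) + (W χ * A + W χ * B))                  ≡⟨ cong (λ z → W (deviation w) - z) change ⟨
      W (deviation w) - W (deviation (adjᵃ a ∘ᵃ w))                              ∎)
      where
      open ≡-Reasoning
      x : ℤ → ℤ
      x = from w
      -- With d = y - x y, these are the changes (d + 1)² - d² = 1 + 2d at y = a and (d - 1)² - d² =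
      -- 1 - 2d at y = a + 1. Their sum is 2 (x (a + 1) - x a), negative by `inv`.
      A B : ℤ
      A = 1ℤ + + 2 * (a - x a)
      B = 1ℤ - + 2 * (a + 1ℤ - x (a + 1ℤ))
      eq₀ : ∀ d c A B → 0ℤ - c * (A + B) ≡ d - (d + (c * A + c * B))
      eq₀ = solve-∀
      A+B<0 : A + B < 0ℤ
      A+B<0 = <-difference (*-monoˡ-<-pos (+ 2) inv) (eq (x a) (x (a + 1ℤ)) a)
        where
        eq : ∀ xa xb a → + 2 * xa - + 2 * xb ≡ 0ℤ - (1ℤ + + 2 * (a - xa) + (1ℤ - + 2 * (a + 1ℤ - xb)))
        eq = solve-∀
      negative-change : W χ * (A + B) < 0ℤ
      negative-change = subst (W χ * (A + B) <_) (*-zeroʳ (W χ)) (*-monoˡ-<-pos (W χ) {{positive 0<W-χ}} A+B<0)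
      h : ℤ → ℤ
      h y = (adj a y - x y) * (adj a y - x y)
      pointwise : ∀ y → h y ≡ deviation w y + (χ (y - a) * A + χ (y - (a + 1ℤ)) * B)
      pointwise y = go (adj-view a y)
        where
        up-square : ∀ a b z B {y x c d} → y ≡ a + z → x ≡ b + z → c ≡ 1ℤ → d ≡ 0ℤ →
          (y + 1ℤ - x) * (y + 1ℤ - x) ≡ (y - x) * (y - x) + (c * (1ℤ + + 2 * (a - b)) + d * B)
        up-square a b z B refl refl refl refl = eq a b z B
          where
          eq : ∀ a b z B → (a + z + 1ℤ - (b + z)) * (a + z + 1ℤ - (b + z)) ≡
               (a + z - (b + z)) * (a + z - (b + z)) + (1ℤ * (1ℤ + + 2 * (a - b)) + 0ℤ * B)
          eq = solve-∀
        down-square : ∀ a b z A {y x c d} → y ≡ a + z → x ≡ b + z → c ≡ 0ℤ → d ≡ 1ℤ →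
          (y - 1ℤ - x) * (y - 1ℤ - x) ≡ (y - x) * (y - x) + (c * A + d * (1ℤ - + 2 * (a - b)))
        down-square a b z A refl refl refl refl = eq a b z A
          where
          eq : ∀ a b z A → (a + z - 1ℤ - (b + z)) * (a + z - 1ℤ - (b + z)) ≡
               (a + z - (b + z)) * (a + z - (b + z)) + (0ℤ * A + 1ℤ * (1ℤ - + 2 * (a - b)))
          eq = solve-∀
        fixed-square : ∀ e A B {c d} → c ≡ 0ℤ → d ≡ 0ℤ → e ≡ e + (c * A + d * B)
        fixed-square e A B refl refl = eq e A B
          where
          eq : ∀ e A B → e ≡ e + (0ℤ * A + 0ℤ * B)
          eq = solve-∀
        go : ∀ {y′} → Adj a y y′ → (y′ - x y) * (y′ - x y) ≡ deviation w y + (χ (y - a) * A + χ (y - (a + 1ℤ)) * B)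
        go (up y≋a@(multiple k eq)) = up-square a (x a) (k * N) B eq
          (trans (cong x eq) (from-+ w k a)) (χ-yes y≋a) (χ-no (i≢i+1-mod y≋a))
        go (down y≋a+1@(multiple k eq)) = down-square (a + 1ℤ) (x (a + 1ℤ)) (k * N) A eq
          (trans (cong x eq) (from-+ w k (a + 1ℤ))) (χ-no (λ y≋a → i≢i+1-mod y≋a y≋a+1)) (χ-yes y≋a+1)
        go (fixed y≋̸a y≋̸a+1) = fixed-square (deviation w y) A B (χ-no y≋̸a) (χ-no y≋̸a+1)
      h-periodic : Periodic h
      h-periodic y = cong (λ z → z * z) (trans
        (cong₂ _-_ (swap-equivariant i≋̸i+1 y) (from-equivariant w y)) (eq (adj a y) (x y) N))
        where
        eq : ∀ y z N → y + N - (z + N) ≡ y - z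
        eq = solve-∀
      W-χ* : ∀ r c → W (λ y → χ (y - r) * c) ≡ W χ * c
      W-χ* r c = trans (W-* c (λ y → χ (y - r))) (cong (λ z → z * c) (W-χ r))
      change : W (deviation (adjᵃ a ∘ᵃ w)) ≡ W (deviation w) + (W χ * A + W χ * B)
      change = begin
        W (deviation (adjᵃ a ∘ᵃ w))
          ≡⟨ W-cong (λ y → cong (λ z → (z - x (adj a y)) * (z - x (adj a y))) (sym (adj-involutive a y))) ⟩
        W (h ∘ adj a)
          ≡⟨ W-∘ (adjᵃ a) h h-periodic ⟩
        W h
          ≡⟨ W-cong pointwise ⟩
        W (λ y → deviation w y + (χ (y - a) * A + χ (y - (a + 1ℤ)) * B))
          ≡⟨ W-+ (deviation w) (λ y → χ (y - a) * A + χ (y - (a + 1ℤ)) * B) ⟩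
        W (deviation w) + W (λ y → χ (y - a) * A + χ (y - (a + 1ℤ)) * B)
          ≡⟨ cong (λ z → W (deviation w) + z) (W-+ (λ y → χ (y - a) * A) (λ y → χ (y - (a + 1ℤ)) * B)) ⟩
        W (deviation w) + (W (λ y → χ (y - a) * A) + W (λ y → χ (y - (a + 1ℤ)) * B))
          ≡⟨ cong₂ (λ y z → W (deviation w) + (y + z)) (W-χ* a A) (W-χ* (a + 1ℤ) B) ⟩
        W (deviation w) + (W χ * A + W χ * B)
          ∎

    step-increasing : ∀ (f : ℤ → ℤ) → (∀ x → f x < f (x + 1ℤ)) → ∀ {x y} → x < y → f x < f y
    step-increasing f step {x} x<y with ≤⇒∃+ (<⇒+1≤ x<y)
    ... | m , refl = go m
      where
      go : ∀ m → f x < f (x + 1ℤ + + m)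
      go zero    = subst (λ z → f x < f z) (sym (+-identityʳ (x + 1ℤ))) (step x)
      go (suc m) = <-trans (go m) (subst (λ z → f (x + 1ℤ + + m) < f z) (eq x (+ m)) (step (x + 1ℤ + + m)))
        where
        eq : ∀ x m → x + 1ℤ + m + 1ℤ ≡ x + 1ℤ + (1ℤ + m)
        eq = solve-∀

    W-deviation-nonneg : ∀ w → 0ℤ ≤ W (deviation w)
    W-deviation-nonneg w = subst (_≤ W (deviation w)) (trans (W-const 0ℤ) (*-zeroʳ N))
      (sum-mono-≤ {n} (λ i → square-nonneg (pos i - from w (pos i))))

    adj-difference-≋ : ∀ (w : AP) {x y} → x ≋ y →
                       from w y - from w (y + 1ℤ) ≡ from w x - from w (x + 1ℤ)
    adj-difference-≋ w {y = y} (multiple k refl) = begin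
      from w y - from w (y + 1ℤ)                            ≡⟨ eq′ (from w y) (from w (y + 1ℤ)) (k * N) ⟩
      (from w y + k * N) - (from w (y + 1ℤ) + k * N)        ≡⟨ cong₂ _-_ (from-+ w k y) (from-+ w k (y + 1ℤ)) ⟨
      from w (y + k * N) - from w (y + 1ℤ + k * N)          ≡⟨ cong (λ z → from w (y + k * N) - from w z) (eq″ y (k * N)) ⟩
      from w (y + k * N) - from w (y + k * N + 1ℤ)          ∎
      where
      open ≡-Reasoning
      eq′ : ∀ a b z → a - b ≡ (a + z) - (b + z)
      eq′ = solve-∀
      eq″ : ∀ x z → x + 1ℤ + z ≡ x + z + 1ℤ
      eq″ = solve-∀

    Descent⁻¹ : AP → Fin n → Set
    Descent⁻¹ w i = from w (pos i + 1ℤ) < from w (pos i)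

    no-descents⇒id : ∀ (w : AP) → ¬ (∃[ i ] Descent⁻¹ w i) → ∀ x → x ≡ to w x
    no-descents⇒id w none x = trans (sym (to-from w x))
      (cong (to w) (increasing⇒id (w ⁻¹ᵃ) (step-increasing (from w) step) x))
      where
      step : ∀ x → from w x < from w (x + 1ℤ)
      step x = ≮∧≢⇒> (λ inv → none (resid x , <-difference inv (adj-difference-≋ w (pos-resid x))))
                     (λ eq → i≢i+1 x (sym (from-injective w eq)))

    -- Each step removes a descent of the inverse and lowers the nonnegative integer
    -- `W (deviation w)`, which serves as fuel. Once no descent is left, the inverse is increasing.
    word : ∀ (w : AP) → ∃[ is ] (wp is ≗ to w)
    word w = start (≤⇒∃+ (W-deviation-nonneg w))
      where
      find : ∀ w → Dec (∃[ i ] Descent⁻¹ w i)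
      find w = Fin.any? λ i → from w (pos i + 1ℤ) <? from w (pos i)
      go : ∀ m w → W (deviation w) ≤ + m → Dec (∃[ i ] Descent⁻¹ w i) → ∃[ is ] (wp is ≗ to w)
      go m       w bound (no none)       = [] , no-descents⇒id w none
      go zero    w bound (yes (i , inv)) =
        ⊥-elim (<⇒≱ (<-≤-trans (adj-deviation w (pos i) inv) bound) (W-deviation-nonneg (adjᵃ (pos i) ∘ᵃ w)))
      go (suc m) w bound (yes (i , inv)) =
        let w′ = adjᵃ (pos i) ∘ᵃ w
            is , is≗ = go m w′ (<⇒≤-1 (<-≤-trans (adj-deviation w (pos i) inv) bound)) (find w′)
        in i ∷ is , λ x → trans (generator≗adj i _) (trans (cong (adj (pos i)) (is≗ x)) (adj-involutive (pos i) (to w x)))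
      start : (∃[ m ] W (deviation w) ≡ 0ℤ + + m) → ∃[ is ] (wp is ≗ to w)
      start (m , eq) = go m w (≤-reflexive (trans eq (+-identityˡ (+ m)))) (find w)

    -- Projections are the 231-avoiding orders

    Between : ℤ → ℤ → ℤ → Set
    Between i c j = (i < c × c < j) ⊎ (j < c × c < i)

    between-trans : ∀ {i c d j} → Between i c j → Between c d j → Between i d j
    between-trans (inj₁ (i<c , c<j)) (inj₁ (c<d , d<j)) = inj₁ (<-trans i<c c<d , d<j)
    between-trans (inj₁ (i<c , c<j)) (inj₂ (j<d , d<c)) = ⊥-elim (<-asym c<j (<-trans j<d d<c))
    between-trans (inj₂ (j<c , c<i)) (inj₁ (c<d , d<j)) = ⊥-elim (<-asym j<c (<-trans c<d d<j))
    between-trans (inj₂ (j<c , c<i)) (inj₂ (j<d , d<c)) = inj₂ (j<d , <-trans d<c c<i)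

    -- `Below` with the meets and joins unfolded: j has the maximum of f on the interval from i to
    -- j, that is, j is i or an ancestor of i.
    Bel : (ℤ → ℤ) → ℤ → ℤ → Set
    Bel f i j = f i ≤ f j × (∀ c → Between i c j → f c ≤ f j)

    bel-between : ∀ f {i c j} → Bel f i j → Between i c j → Bel f c j
    bel-between f (_ , bound) b = bound _ b , λ d b′ → bound d (between-trans b b′)

    module _ (w : AP) {i j : ℤ} where

      below⇒bel : Below w i j → Bel (to w) i j
      below⇒bel (¬sep , le) = le , λ c b → ≮⇒≥ λ j<c → ¬sep (c , lower b , upper b ,
        subst (_< to w c) (sym (i≤j⇒i⊔j≡j le)) j<c)
        where
        lower : ∀ {c} → Between i c j → i ⊓ j < c
        lower (inj₁ (i<c , _)) = ≤-<-trans (i⊓j≤i i j) i<c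
        lower (inj₂ (j<c , _)) = ≤-<-trans (i⊓j≤j i j) j<c
        upper : ∀ {c} → Between i c j → c < i ⊔ j
        upper (inj₁ (_ , c<j)) = <-≤-trans c<j (i≤j⊔i i j)
        upper (inj₂ (_ , c<i)) = <-≤-trans c<i (i≤i⊔j i j)

      bel⇒below : Bel (to w) i j → Below w i j
      bel⇒below (le , bound) = (λ (c , lower , upper , above) →
        <⇒≱ (≤-<-trans (i≤j⊔i (to w i) (to w j)) above) (bound c (between lower upper))) , le
        where
        between : ∀ {c} → i ⊓ j < c → c < i ⊔ j → Between i c j
        between lower upper with ≤-total i j
        ... | inj₁ i≤j = inj₁ (subst (_< _) (i≤j⇒i⊓j≡i i≤j) lower , subst (_ <_) (i≤j⇒i⊔j≡j i≤j) upper)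
        ... | inj₂ j≤i = inj₂ (subst (_< _) (i≥j⇒i⊓j≡j j≤i) lower , subst (_ <_) (i≥j⇒i⊔j≡i j≤i) upper)

    syl-bel : ∀ {v u : AP} → v ≡syl u → ∀ {i j} → Bel (to v) i j → Bel (to u) i j
    syl-bel {v} {u} v≡u {i} {j} b = below⇒bel u (Equivalence.to (v≡u i j) (bel⇒below v b))

    syl-sym : ∀ {v u : AP} → v ≡syl u → u ≡syl v
    syl-sym v≡u i j = mk⇔ (Equivalence.from (v≡u i j)) (Equivalence.to (v≡u i j))

    syl-trans : ∀ {v u w : AP} → v ≡syl u → u ≡syl w → v ≡syl w
    syl-trans v≡u u≡w i j = mk⇔ (Equivalence.to (u≡w i j) ∘ Equivalence.to (v≡u i j))
                                (Equivalence.from (v≡u i j) ∘ Equivalence.from (u≡w i j))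

    -- A labelling v that decreases along the tree of u has the same tree: over any
    -- interval the maximum of v sits where the maximum of u does.
    decreasing⇒syl : ∀ {v u : AP} → (∀ {i j} → Bel (to u) i j → to v i ≤ to v j) → v ≡syl u
    decreasing⇒syl {v} {u} dec i j =
      mk⇔ (bel⇒below u ∘ backward ∘ below⇒bel v) (bel⇒below v ∘ forward ∘ below⇒bel u)
      where
      forward : ∀ {i j} → Bel (to u) i j → Bel (to v) i j
      forward b = dec b , λ c btw → dec (bel-between (to u) b btw)

      module _ {l r m} (max : ∀ c → l ≤ c → c ≤ r → to u c ≤ to u m) (l≤m : l ≤ m) (m≤r : m ≤ r) where
        top : ∀ {c} → l ≤ c → c ≤ r → Bel (to u) c m
        top l≤c c≤r = max _ l≤c c≤r , λ where
          d (inj₁ (c<d , d<m)) → max d (≤-trans l≤c (<⇒≤ c<d)) (≤-trans (<⇒≤ d<m) m≤r)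
          d (inj₂ (m<d , d<c)) → max d (≤-trans l≤m (<⇒≤ m<d)) (≤-trans (<⇒≤ d<c) c≤r)

      -- In the tree of `u` the position m lies above j, so by `dec` its `v`-value is at least that
      -- of j. As j already has the largest `v`-value on the interval, m is j.
      top≡ : ∀ {i j m} → Bel (to v) i j → Bel (to u) i m → Bel (to u) j m →
             m ≡ i ⊎ m ≡ j ⊎ Between i m j → Bel (to u) i j
      top≡ (i≤j , _) bi bj (inj₁ refl) with refl ← to-injective v (≤-antisym i≤j (dec bj)) = bi
      top≡ _ bi bj (inj₂ (inj₁ refl)) = bi
      top≡ (_ , bound) bi bj (inj₂ (inj₂ btw)) with refl ← to-injective v (≤-antisym (bound _ btw) (dec bj)) = bi

      backward : ∀ {i j} → Bel (to v) i j → Bel (to u) i j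
      backward {i} {j} b with ≤-total i j
      ... | inj₁ i≤j with m , i≤m , m≤j , max ← argmax (to u) i≤j =
        top≡ b (top max i≤m m≤j ≤-refl i≤j) (top max i≤m m≤j i≤j ≤-refl) position
        where
        position : m ≡ i ⊎ m ≡ j ⊎ Between i m j
        position with m ≟ i | m ≟ j
        ... | yes m≡i | _       = inj₁ m≡i
        ... | no  _   | yes m≡j = inj₂ (inj₁ m≡j)
        ... | no  m≢i | no  m≢j = inj₂ (inj₂ (inj₁ (≤∧≢⇒< i≤m (m≢i ∘ sym) , ≤∧≢⇒< m≤j m≢j)))
      backward {i} {j} b | inj₂ j≤i with m , j≤m , m≤i , max ← argmax (to u) j≤i =
        top≡ b (top max j≤m m≤i j≤i ≤-refl) (top max j≤m m≤i ≤-refl j≤i) position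
        where
        position : m ≡ i ⊎ m ≡ j ⊎ Between i m j
        position with m ≟ i | m ≟ j
        ... | yes m≡i | _       = inj₁ m≡i
        ... | no  _   | yes m≡j = inj₂ (inj₁ m≡j)
        ... | no  m≢i | no  m≢j = inj₂ (inj₂ (inj₂ (≤∧≢⇒< j≤m (m≢j ∘ sym) , ≤∧≢⇒< m≤i m≢i)))

    Avoids231 : (ℤ → ℤ) → Set
    Avoids231 f = ∀ {i j k} → i < j → j < k → f k < f i → f i < f j → ⊥

    -- In a 231 pattern with values b c a, some consecutive values between a and b
    -- lie on opposite sides of c; exchanging them keeps the tree and removes an
    -- inversion.
    projection⇒avoids231 : ∀ {w u : AP} → IsProjection w u → Avoids231 (to u)
    projection⇒avoids231 {w} {u} (u≡w , minimal) {i} {j} {k} i<j j<k uk<ui ui<uj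
      -- `s` is the least value from `to u k` on that occurs left of the peak j; it is at most
      -- `to u i`. Its predecessor therefore occurs right of j.
      with s , uk≤s , s≤ui , s<j , min ← least (λ a → from u a <? j) (<⇒≤ uk<ui)
                                           (subst (_< j) (sym (from-to u i)) i<j) =
      adj≤L u a (proj₁ (word u)) (proj₂ (word u)) inv λ v≤u →
        i≢i+1 a (sym (trans (sym (trans (cong (adj a) (to-from u a)) (adj-unique (up ≋-refl))))
          (trans (minimal v (syl-trans {v} {u} {w} (decreasing⇒syl {v} {u} decreasing) u≡w) v≤u (from u a)) (to-from u a))))
      where
      a : ℤ
      a = s - 1ℤ
      v : AP
      v = adjᵃ a ∘ᵃ u
      a+1≡s : a + 1ℤ ≡ s
      a+1≡s = i-1+1≡i s
      uk≢s : to u k ≢ s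
      uk≢s refl = <-asym j<k (subst (_< j) (from-to u k) s<j)
      Pa>j : j < from u a
      Pa>j = ≮∧≢⇒> (min a (<⇒≤-1 (≤∧≢⇒< uk≤s uk≢s)) (i-1<i s))
        λ eq → <-irrefl (trans (sym (to-from u a)) (cong (to u) eq)) (<-≤-trans (i-1<i s) (≤-trans s≤ui (<⇒≤ ui<uj)))
      Pa+1<j : from u (a + 1ℤ) < j
      Pa+1<j = subst (λ z → from u z < j) (sym a+1≡s) s<j
      inv : from u (a + 1ℤ) < from u a
      inv = <-trans Pa+1<j Pa>j
      a+1<uj : a + 1ℤ < to u j
      a+1<uj = subst (_< to u j) (sym a+1≡s) (≤-<-trans s≤ui ui<uj)
      -- Two exchanged values occur on opposite sides of a translate of j, whose value exceeds both.
      -- So neither position is an ancestor of the other, and the exchange respects the tree.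
      separated : ∀ {p q} → Bel (to u) p q → to u p ≋ a → to u q ≢ to u p + 1ℤ
      separated {p} {q} (_ , bound) (multiple k up≡) uq≡ = <⇒≱ a+1<uj (≤-difference (bound (j + k * N) (inj₂
          (subst (_< j + k * N) (sym q≡) (+-monoˡ-< (k * N) Pa+1<j) ,
           subst (j + k * N <_) (sym p≡) (+-monoˡ-< (k * N) Pa>j))))
          (trans (cong₂ _-_ uq≡′ (to-+ u k j)) (eq₂ (a + 1ℤ) (to u j) (k * N))))
        where
        eq₁ : ∀ a z → a + z + 1ℤ ≡ a + 1ℤ + z
        eq₁ = solve-∀
        eq₂ : ∀ a b z → a + z - (b + z) ≡ a - b
        eq₂ = solve-∀
        uq≡′ : to u q ≡ a + 1ℤ + k * N
        uq≡′ = trans uq≡ (trans (cong (λ z → z + 1ℤ) up≡) (eq₁ a (k * N)))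
        p≡ : p ≡ from u a + k * N
        p≡ = trans (sym (from-to u p)) (trans (cong (from u) up≡) (from-+ u k a))
        q≡ : q ≡ from u (a + 1ℤ) + k * N
        q≡ = trans (sym (from-to u q)) (trans (cong (from u) uq≡′) (from-+ u k (a + 1ℤ)))
      decreasing : ∀ {p q} → Bel (to u) p q → to v p ≤ to v q
      decreasing {p} {q} b@(up≤uq , _) with p ≟ q
      ... | yes refl = ≤-refl
      ... | no  p≢q  = ≮⇒≥ λ vq<vp →
        let up≋a , uq≡up+1 = adj-inverts (≤∧≢⇒< up≤uq (p≢q ∘ to-injective u)) vq<vp
        in separated b up≋a uq≡up+1

    -- For an inversion of `u` at p < q, avoidance puts q below p in the tree, so every member of
    -- the class inverts this pair. A smaller `v` in weak order has no other inversions, so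
    -- `v ∘ u⁻¹` is increasing.
    avoids231⇒projection : ∀ {w u : AP} → u ≡syl w → Avoids231 (to u) → IsProjection w u
    avoids231⇒projection {w} {u} u≡w avoids = u≡w , minimal
      where
      minimal : ∀ v → v ≡syl w → v ≤L u → v ≈ u
      minimal v v≡w v≤u x = trans (cong (to v) (sym (from-to u x))) (increasing⇒id (v ∘ᵃ (u ⁻¹ᵃ)) increasing (to u x))
        where
        keeps : ∀ {p q} → p < q → to u q < to u p → to v q < to v p
        keeps {p} {q} p<q inv = ≤∧≢⇒< (proj₁ (syl-bel {u} {v} (syl-trans {u} {w} {v} u≡w (syl-sym {v} {w} v≡w)) bel))
                                      (λ eq → <-irrefl (sym (to-injective v eq)) p<q)
          where
          bel : Bel (to u) q p
          bel = <⇒≤ inv , λ where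
            c (inj₁ (q<c , c<p)) → ⊥-elim (<-asym p<q (<-trans q<c c<p))
            c (inj₂ (p<c , c<q)) → ≮⇒≥ (avoids p<c c<q inv)
        increasing : ∀ {x y} → x < y → to v (from u x) < to v (from u y)
        increasing {x} {y} x<y with <-cmp (from u x) (from u y)
        ... | tri≈ _ eq _ = ⊥-elim (<-irrefl (from-injective u eq) x<y)
        ... | tri> _ _ gt = keeps gt (subst₂ _<_ (sym (to-from u x)) (sym (to-from u y)) x<y)
        ... | tri< lt _ _ = ≮∧≢⇒> (λ inv → <-asym x<y (subst₂ _<_ (to-from u y) (to-from u x) (≤L⇒inversions {v} {u} v≤u lt inv)))
                                  (λ eq → <-irrefl (sym (to-injective v eq)) lt)

    -- Preimages of `w` as trees labelled by `w`

    record Valid (w u : AP) : Set where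
      constructor valid
      field
        avoids     : Avoids231 (to u)
        decreasing : ∀ {i j} → Bel (to u) i j → to w (to u i) ≤ to w (to u j)

    preimage⇒valid : ∀ {v w : AP} → StackSortsTo v w → ∃[ u ] (Valid w u × to v ≗ to w ∘ to u)
    preimage⇒valid {v} {w} (u , proj@(u≡v , _) , w≗) = u , valid (projection⇒avoids231 {v} {u} proj) dec , v≗
      where
      v≗ : to v ≗ to w ∘ to u
      v≗ x = sym (trans (w≗ (to u x)) (cong (to v) (from-to u x)))
      dec : ∀ {i j} → Bel (to u) i j → to w (to u i) ≤ to w (to u j)
      dec {i} {j} b = subst₂ _≤_ (v≗ i) (v≗ j) (proj₁ (syl-bel {u} {v} u≡v b))

    valid⇒preimage : ∀ {w u : AP} → Valid w u → StackSortsTo (w ∘ᵃ u) w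
    valid⇒preimage {w} {u} (valid avoids dec) =
      u , avoids231⇒projection {w ∘ᵃ u} {u} (syl-sym {w ∘ᵃ u} {u} (decreasing⇒syl {w ∘ᵃ u} {u} dec)) avoids ,
      λ x → cong (to w) (sym (to-from u x))

    -- Leaves and descents

    ind : ∀ {P : Set} → Dec P → ℤ
    ind P? = if does P? then 1ℤ else 0ℤ

    ind-yes : ∀ {P : Set} (P? : Dec P) → P → ind P? ≡ 1ℤ
    ind-yes (yes _) _ = refl
    ind-yes (no ¬p) p = ⊥-elim (¬p p)

    ind-no : ∀ {P : Set} (P? : Dec P) → ¬ P → ind P? ≡ 0ℤ
    ind-no (yes p) ¬p = ⊥-elim (¬p p)
    ind-no (no _)  _  = refl

    length-filter : ∀ {A : Set} {P : A → Set} (P? : ∀ a → Dec (P a)) {m} (f : Fin m → A) →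
                    + length (filter P? (tabulate f)) ≡ sum {m} (λ i → ind (P? (f i)))
    length-filter P? {zero}  f = refl
    length-filter P? {suc m} f with P? (f Fin.zero)
    ... | yes _ = cong (λ z → 1ℤ + z) (length-filter P? (f ∘ Fin.suc))
    ... | no  _ = trans (length-filter P? (f ∘ Fin.suc)) (sym (+-identityˡ _))

    -- `b` is the node visited just before `q` in postorder.
    module Predecessor (u : AP) (q : ℤ) where

      b : ℤ
      b = from u (to u q - 1ℤ)

      ub : to u b ≡ to u q - 1ℤ
      ub = to-from u (to u q - 1ℤ)

      ub<uq : to u b < to u q
      ub<uq = subst (_< to u q) (sym ub) (i-1<i (to u q))

      below-b : ∀ {c} → to u c < to u q → c ≢ b → to u c < to u b
      below-b uc<uq c≢b = ≤∧≢⇒< (subst (to u _ ≤_) (sym ub) (<⇒≤-1 uc<uq)) (c≢b ∘ to-injective u)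

      -- If b were to the right, the positions q, q + 1, b would form a 231 pattern.
      ascent⇒b<q : Avoids231 (to u) → to u q < to u (q + 1ℤ) → b < q
      ascent⇒b<q avoids ascent = ≮∧≢⇒>
        (λ q<b → avoids (i<i+1 q)
          (≤∧≢⇒< (<⇒+1≤ q<b) (λ eq → <-asym ub<uq (subst (λ z → to u q < to u z) eq ascent)))
          ub<uq ascent)
        (λ eq → <-irrefl (cong (to u) (sym eq)) ub<uq)

    module _ (w : AP) where

      -- The label after a descent of w is a leaf of every tree that w labels.
      Leaf : ℤ → Set
      Leaf y = to w y < to w (y - 1ℤ)

      leaf? : ∀ y → Dec (Leaf y)
      leaf? y = to w y <? to w (y - 1ℤ)

      δ : ℤ → ℤ
      δ y = ind (leaf? y)

      δ-periodic : Periodic δ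
      δ-periodic y = case leaf? y of λ where
          (yes l) → trans (ind-yes (leaf? (y + N)) (<-difference l shifted)) (sym (ind-yes (leaf? y) l))
          (no ¬l) → trans (ind-no (leaf? (y + N)) (λ l → ¬l (<-difference l (sym shifted)))) (sym (ind-no (leaf? y) ¬l))
        where
        eq₁ : ∀ y N → y + N - 1ℤ ≡ y - 1ℤ + N
        eq₁ = solve-∀
        eq₂ : ∀ a b N → a - b ≡ a + N - (b + N)
        eq₂ = solve-∀
        shifted : to w (y - 1ℤ) - to w y ≡ to w (y + N - 1ℤ) - to w (y + N)
        shifted = begin
          to w (y - 1ℤ) - to w y                    ≡⟨ eq₂ (to w (y - 1ℤ)) (to w y) N ⟩
          to w (y - 1ℤ) + N - (to w y + N)          ≡⟨ cong₂ _-_ (AffinePermutation.periodic w (y - 1ℤ)) (AffinePermutation.periodic w y) ⟨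
          to w (y - 1ℤ + N) - to w (y + N)          ≡⟨ cong (λ z → to w z - to w (y + N)) (eq₁ y N) ⟨
          to w (y + N - 1ℤ) - to w (y + N)          ∎
          where open ≡-Reasoning

      W-δ : W δ ≡ + length (descents w)
      W-δ = begin
        W δ                           ≡⟨ W-shift δ 1ℤ δ-periodic ⟨
        W (λ y → δ (y + 1ℤ))          ≡⟨ W-cong (λ y → cong (λ z → ind (to w (y + 1ℤ) <? to w z)) (i+1-1≡i y)) ⟩
        W (λ y → ind (to w (y + 1ℤ) <? to w y))
          ≡⟨ length-filter {P = λ i → to w (pos i + 1ℤ) < to w (pos i)} (λ i → to w (pos i + 1ℤ) <? to w (pos i)) {n} id ⟨
        + length (descents w)         ∎
        where open ≡-Reasoning

      module _ (u : AP) where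

        LeafAt : ℤ → Set
        LeafAt q = Leaf (to u q)

        leafAt? : ∀ q → Dec (LeafAt q)
        leafAt? q = leaf? (to u q)

        -- Each position lies in two adjacent pairs, so summing over a window counts every descent
        -- twice. This is where n/2 comes from.
        leafCount : ℤ → ℤ
        leafCount q = δ (to u q) + δ (to u (q + 1ℤ))

        leafCount-periodic : Periodic leafCount
        leafCount-periodic q = cong₂ _+_ (at q) (trans (cong (λ z → δ (to u z)) (eq q N)) (at (q + 1ℤ)))
          where
          eq : ∀ q N → q + N + 1ℤ ≡ q + 1ℤ + N
          eq = solve-∀
          at : ∀ q → δ (to u (q + N)) ≡ δ (to u q)
          at q = trans (cong δ (AffinePermutation.periodic u q)) (δ-periodic (to u q))

        W-leafCount : W leafCount ≡ + (2 ℕ.* length (descents w))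
        W-leafCount = begin
          W leafCount                                                 ≡⟨ W-+ (δ ∘ to u) (λ q → δ (to u (q + 1ℤ))) ⟩
          W (δ ∘ to u) + W (λ q → δ (to u (q + 1ℤ)))                  ≡⟨ cong (λ z → W (δ ∘ to u) + z) (W-shift (δ ∘ to u) 1ℤ δu-periodic) ⟩
          W (δ ∘ to u) + W (δ ∘ to u)                                 ≡⟨ cong₂ _+_ Wδu Wδu ⟩
          + length (descents w) + + length (descents w)               ≡⟨ cong (λ z → + (length (descents w) ℕ.+ z)) (ℕ.+-identityʳ (length (descents w))) ⟨
          + (2 ℕ.* length (descents w))                               ∎
          where
          open ≡-Reasoning
          δu-periodic : Periodic (δ ∘ to u)
          δu-periodic q = trans (cong δ (AffinePermutation.periodic u q)) (δ-periodic (to u q))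
          Wδu : W (δ ∘ to u) ≡ + length (descents w)
          Wδu = trans (W-∘ u δ δ-periodic) W-δ

        all-leafCount⇒descents : (∀ i → leafCount (pos i) ≡ 1ℤ) → 2 ℕ.* length (descents w) ≡ n
        all-leafCount⇒descents all = +-injective (begin
          + (2 ℕ.* length (descents w))  ≡⟨ W-leafCount ⟨
          W leafCount                    ≡⟨ sum-cong-≗ {n} all ⟩
          W (λ _ → 1ℤ)                   ≡⟨ W-const 1ℤ ⟩
          N * 1ℤ                         ≡⟨ *-identityʳ N ⟩
          N                              ∎)
          where open ≡-Reasoning

        descents⇒leafCount : (∀ q → leafCount q ≤ 1ℤ) → 2 ℕ.* length (descents w) ≡ n →
                             ∀ q → leafCount q ≡ 1ℤ
        descents⇒leafCount bound total q = trans (periodic-≋ leafCount leafCount-periodic (≋-sym (pos-resid q)))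
          (≤-antisym (bound _) (≮⇒≥ λ lt → <-irrefl sums
            (sum-mono-< {n} {leafCount ∘ pos} {λ _ → 1ℤ} (bound ∘ pos) (resid q) lt)))
          where
          sums : W leafCount ≡ W (λ _ → 1ℤ)
          sums = trans W-leafCount (trans (cong +_ total) (trans (sym (*-identityʳ N)) (sym (W-const 1ℤ))))

      module _ {u : AP} (val : Valid w u) where
        open Valid val

        leaf-predecessor : ∀ {q} → LeafAt u q → ¬ Bel (to u) (from u (to u q - 1ℤ)) q
        leaf-predecessor {q} leaf b = <⇒≱ leaf (subst (λ z → to w z ≤ to w (to u q)) (to-from u _) (decreasing b))

        -- A node with a child is visited right after one of its children, but by `leaf-predecessor`
        -- the node visited before q is not below q. The same reason gives `leaf⇒valleyˡ`.
        leaf⇒valleyʳ : ∀ {q} → LeafAt u q → to u q < to u (q + 1ℤ)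
        leaf⇒valleyʳ {q} leaf = ≮∧≢⇒> (λ lt → leaf-predecessor leaf (<⇒≤ (Predecessor.ub<uq u q) , bound lt))
                                      (λ eq → i≢i+1 q (sym (to-injective u eq)))
          where
          open Predecessor u q
          bound : to u (q + 1ℤ) < to u q → ∀ c → Between b c q → to u c ≤ to u q
          bound lt c (inj₁ (b<c , c<q)) = ≮⇒≥ λ uq<uc → avoids b<c (<-trans c<q (i<i+1 q))
            (below-b lt λ eq → <-asym (<-trans b<c c<q) (subst (q <_) eq (i<i+1 q)))
            (<-trans ub<uq uq<uc)
          bound lt c (inj₂ (q<c , c<b)) = ≮⇒≥ (avoids q<c c<b ub<uq)

        leaf⇒valleyˡ : ∀ {q} → LeafAt u q → to u q < to u (q - 1ℤ)
        leaf⇒valleyˡ {q} leaf = ≮∧≢⇒> (λ lt → leaf-predecessor leaf (<⇒≤ (Predecessor.ub<uq u q) , bound lt))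
                                      (λ eq → i≢i-1 q (sym (to-injective u eq)))
          where
          open Predecessor u q
          bound : to u (q - 1ℤ) < to u q → ∀ c → Between b c q → to u c ≤ to u q
          bound lt c (inj₁ (b<c , c<q)) = ≮⇒≥ λ uq<uc →
            let c<q-1 = ≤∧≢⇒< (<⇒≤-1 c<q) λ eq → <-asym uq<uc (subst (λ z → to u z < to u q) (sym eq) lt)
            in avoids b<c c<q-1 (below-b lt λ eq → <-irrefl (sym eq) (<-trans b<c c<q-1)) (<-trans ub<uq uq<uc)
          bound lt c (inj₂ (q<c , c<b)) = ≮⇒≥ (avoids q<c c<b ub<uq)

        leaf⇒next-not-leaf : ∀ {q} → LeafAt u q → ¬ LeafAt u (q + 1ℤ)
        leaf⇒next-not-leaf {q} leaf leaf′ = <-asym (leaf⇒valleyʳ leaf)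
          (subst (λ z → to u (q + 1ℤ) < to u z) (i+1-1≡i q) (leaf⇒valleyˡ leaf′))

        leafCount-≤1 : ∀ q → leafCount u q ≤ 1ℤ
        leafCount-≤1 q = go (leafAt? u q) (leafAt? u (q + 1ℤ))
          where
          go : ∀ (a : Dec (LeafAt u q)) (b : Dec (LeafAt u (q + 1ℤ))) → ind a + ind b ≤ 1ℤ
          go (yes l) (yes l′) = ⊥-elim (leaf⇒next-not-leaf l l′)
          go (yes _) (no _)   = ≤-refl
          go (no _)  (yes _)  = ≤-refl
          go (no _)  (no _)   = +≤+ z≤n

        leafCount-1 : ∀ q → ¬ (¬ LeafAt u q × ¬ LeafAt u (q + 1ℤ)) → leafCount u q ≡ 1ℤ
        leafCount-1 q some = go (leafAt? u q) (leafAt? u (q + 1ℤ))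
          where
          go : ∀ (a : Dec (LeafAt u q)) (b : Dec (LeafAt u (q + 1ℤ))) → ind a + ind b ≡ 1ℤ
          go (yes l) (yes l′) = ⊥-elim (leaf⇒next-not-leaf l l′)
          go (yes _) (no _)   = refl
          go (no _)  (yes _)  = refl
          go (no ¬l) (no ¬l′) = ⊥-elim (some (¬l , ¬l′))

        leafCount-1⇒leaf : ∀ {q} → leafCount u q ≡ 1ℤ → ¬ (¬ LeafAt u q × ¬ LeafAt u (q + 1ℤ))
        leafCount-1⇒leaf {q} eq (¬l , ¬l′) =
          contradiction (trans (sym eq) (cong₂ _+_ (ind-no (leafAt? u q) ¬l) (ind-no (leafAt? u (q + 1ℤ)) ¬l′))) λ ()

    -- Uniqueness of full trees

    between-split : ∀ {i c j} k → Between i c j → c ≡ k ⊎ Between i c k ⊎ Between k c j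
    between-split {c = c} k b with <-cmp c k | b
    ... | tri≈ _ c≡k _ | _ = inj₁ c≡k
    ... | tri< c<k _ _ | inj₁ (i<c , c<j) = inj₂ (inj₁ (inj₁ (i<c , c<k)))
    ... | tri< c<k _ _ | inj₂ (j<c , c<i) = inj₂ (inj₂ (inj₂ (j<c , c<k)))
    ... | tri> _ _ k<c | inj₁ (i<c , c<j) = inj₂ (inj₂ (inj₁ (k<c , c<j)))
    ... | tri> _ _ k<c | inj₂ (j<c , c<i) = inj₂ (inj₁ (inj₂ (k<c , c<i)))

    -- u orders a full binary tree: labels are in postorder and every node is
    -- either a leaf or has two children.
    record FullTree (Leaf : ℤ → Set) (u : AP) : Set where
      field
        avoids  : Avoids231 (to u)
        valleyˡ : ∀ {q} → Leaf (to u q) → to u q < to u (q - 1ℤ)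
        valleyʳ : ∀ {q} → Leaf (to u q) → to u q < to u (q + 1ℤ)
        peakˡ   : ∀ {q} → ¬ Leaf (to u q) → to u (q - 1ℤ) < to u q
        peakʳ   : ∀ {q} → ¬ Leaf (to u q) → to u (q + 1ℤ) < to u q

    -- Descendants, in terms of labels rather than positions.
    Descendant : AP → ℤ → ℤ → Set
    Descendant u x z = x ≤ z × (∀ c → Between (from u x) (from u c) (from u z) → c ≤ z)

    descendant-refl : ∀ {u x} → Descendant u x x
    descendant-refl = ≤-refl , λ where
      c (inj₁ (l , r)) → ⊥-elim (<-asym l r)
      c (inj₂ (l , r)) → ⊥-elim (<-asym l r)

    descendant-trans : ∀ {u x y z} → Descendant u x y → Descendant u y z → Descendant u x z
    descendant-trans {u} {x} {y} {z} (x≤y , xy) (y≤z , yz) = ≤-trans x≤y y≤z , bound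
      where
      bound : ∀ c → Between (from u x) (from u c) (from u z) → c ≤ z
      bound c b with between-split (from u y) b
      ... | inj₁ eq        = subst (_≤ z) (sym (from-injective u eq)) y≤z
      ... | inj₂ (inj₁ b′) = ≤-trans (xy c b′) y≤z
      ... | inj₂ (inj₂ b′) = yz c b′

    module _ {Leaf : ℤ → Set} {u : AP} (full : FullTree Leaf u) where
      open FullTree full

      avoids-labels : ∀ {x y z} → x < y → y < z → from u y < from u z → from u z < from u x → ⊥
      avoids-labels {x} {y} {z} x<y y<z Py<Pz Pz<Px = avoids Py<Pz Pz<Px
        (subst₂ _<_ (sym (to-from u x)) (sym (to-from u y)) x<y)
        (subst₂ _<_ (sym (to-from u y)) (sym (to-from u z)) y<z)

      private
        leaf-at : ∀ {z} → Leaf z → Leaf (to u (from u z))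
        leaf-at {z} = subst Leaf (sym (to-from u z))

        nonleaf-at : ∀ {z} → ¬ Leaf z → ¬ Leaf (to u (from u z))
        nonleaf-at {z} ¬l l = ¬l (subst Leaf (to-from u z) l)

      -- Any other descendant would equal a neighbour of the leaf or be cut off by it, and both
      -- neighbours carry larger labels.
      leaf-descendant : ∀ {x z} → Leaf z → Descendant u x z → x ≡ z
      leaf-descendant {x} {z} leaf (x≤z , bound) with <-cmp (from u x) (from u z)
      ... | tri≈ _ eq _ = from-injective u eq
      ... | tri< Px<Pz _ _ = ⊥-elim (go (from u x ≟ from u z - 1ℤ))
        where
        lt : z < to u (from u z - 1ℤ)
        lt = subst (_< to u (from u z - 1ℤ)) (to-from u z) (valleyˡ (leaf-at leaf))
        go : Dec (from u x ≡ from u z - 1ℤ) → ⊥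
        go (yes eq) = <⇒≱ lt (subst (_≤ z) (trans (sym (to-from u x)) (cong (to u) eq)) x≤z)
        go (no neq) = <⇒≱ lt (bound _ (inj₁
          (subst (from u x <_) (sym (from-to u _)) (≤∧≢⇒< (<⇒≤-1 Px<Pz) neq) ,
           subst (_< from u z) (sym (from-to u _)) (i-1<i (from u z)))))
      ... | tri> _ _ Pz<Px = ⊥-elim (go (from u z + 1ℤ ≟ from u x))
        where
        lt : z < to u (from u z + 1ℤ)
        lt = subst (_< to u (from u z + 1ℤ)) (to-from u z) (valleyʳ (leaf-at leaf))
        go : Dec (from u z + 1ℤ ≡ from u x) → ⊥
        go (yes eq) = <⇒≱ lt (subst (_≤ z) (trans (sym (to-from u x)) (cong (to u) (sym eq))) x≤z)
        go (no neq) = <⇒≱ lt (bound _ (inj₂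
          (subst (from u z <_) (sym (from-to u _)) (i<i+1 (from u z)) ,
           subst (_< from u x) (sym (from-to u _)) (≤∧≢⇒< (<⇒+1≤ Pz<Px) neq))))

      module _ {z : ℤ} (¬leaf : ¬ Leaf z) where

        -- The label preceding an inner node is its right child.
        right-child : from u z < from u (z - 1ℤ)
        right-child = ≮∧≢⇒> (λ lt → avoids lt (i<i+1 q)
            (≤∧≢⇒< (subst (to u (q + 1ℤ) ≤_) (sym (to-from u (z - 1ℤ))) (<⇒≤-1 peak))
                   λ eq → <-asym lt (subst (q <_) (to-injective u eq) (i<i+1 q)))
            (subst₂ _<_ (sym (to-from u (z - 1ℤ))) (sym (to-from u z)) (i-1<i z)))
          (λ eq → i≢i-1 z (sym (from-injective u eq)))
          where
          q : ℤ
          q = from u z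
          peak : to u (q + 1ℤ) < z
          peak = subst (to u (q + 1ℤ) <_) (to-from u z) (peakʳ (nonleaf-at ¬leaf))

        inverted⇒descendant : ∀ {x} → x < z → from u z < from u x → Descendant u x z
        inverted⇒descendant x<z Pz<Px = <⇒≤ x<z , λ where
          c (inj₁ (Px<Pc , Pc<Pz)) → ⊥-elim (<-asym Pz<Px (<-trans Px<Pc Pc<Pz))
          c (inj₂ (Pz<Pc , Pc<Px)) → ≮⇒≥ λ z<c → avoids-labels x<z z<c Pz<Pc Pc<Px

        -- Smaller labels right of z form its right subtree, whose root is `z - 1`. With the
        -- converse `right⇒inverted`, the side of z on which a smaller label lies becomes a question
        -- about descendants of `z - 1`, which suits induction on labels.
        inverted⇒right : ∀ {x} → x < z → from u z < from u x → Descendant u x (z - 1ℤ)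
        inverted⇒right {x} x<z Pz<Px = <⇒≤-1 x<z , λ c b → ≮⇒≥ λ z-1<c → go c (-1<⇒≤ z-1<c) b
          where
          go : ∀ c → z ≤ c → Between (from u x) (from u c) (from u (z - 1ℤ)) → ⊥
          go c z≤c b with z ≟ c | b
          ... | yes refl | inj₁ (Px<Pz , _)   = <-asym Px<Pz Pz<Px
          ... | yes refl | inj₂ (Pz-1<Pz , _) = <-asym Pz-1<Pz right-child
          ... | no z≢c | inj₁ (Px<Pc , Pc<Pz-1) =
            avoids-labels (i-1<i z) (≤∧≢⇒< z≤c z≢c) (<-trans Pz<Px Px<Pc) Pc<Pz-1
          ... | no z≢c | inj₂ (Pz-1<Pc , Pc<Px) =
            avoids-labels x<z (≤∧≢⇒< z≤c z≢c) (<-trans right-child Pz-1<Pc) Pc<Px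

        right⇒inverted : ∀ {x} → Descendant u x (z - 1ℤ) → from u z < from u x
        right⇒inverted {x} (x≤z-1 , bound) = ≮∧≢⇒>
          (λ Px<Pz → <⇒≱ (i-1<i z) (bound z (inj₁ (Px<Pz , right-child))))
          (λ eq → <-irrefl (from-injective u eq) (≤-<-trans x≤z-1 (i-1<i z)))

        -- k is the left child of z.
        left-descendant : ∀ {k} → k < z → from u k < from u z →
                          (∀ c → k < c → c < z → from u z < from u c) → Descendant u k z
        left-descendant {k} k<z Pk<Pz after = <⇒≤ k<z , λ where
            c (inj₂ (Pz<Pc , Pc<Pk)) → ⊥-elim (<-asym Pk<Pz (<-trans Pz<Pc Pc<Pk))
            c (inj₁ (Pk<Pc , Pc<Pz)) → ≮⇒≥ λ z<c → absurd z<c Pk<Pc Pc<Pz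
          where
          -- The in-order neighbour left of z has a label below z, hence at most k. A label c > z
          -- between k and z would then give the pattern k, c, e.
          e : ℤ
          e = to u (from u z - 1ℤ)
          Pe : from u e ≡ from u z - 1ℤ
          Pe = from-to u _
          e<z : e < z
          e<z = subst (e <_) (to-from u z) (peakˡ (nonleaf-at ¬leaf))
          e≤k : e ≤ k
          e≤k = ≮⇒≥ λ k<e → <-asym (after e k<e e<z) (subst (_< from u z) (sym Pe) (i-1<i _))
          absurd : ∀ {c} → z < c → from u k < from u c → from u c < from u z → ⊥
          absurd {c} z<c Pk<Pc Pc<Pz = avoids-labels e<k (<-trans k<z z<c) Pk<Pc Pc<Pe
            where
            Pc<Pe : from u c < from u e
            Pc<Pe = subst (from u c <_) (sym Pe) (≤∧≢⇒< (<⇒≤-1 Pc<Pz)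
              λ eq → <-asym z<c (subst (_< z) (sym (from-injective u (trans eq (sym Pe)))) e<z))
            e<k : e < k
            e<k = ≤∧≢⇒< e≤k λ eq → <-asym Pc<Pe (subst (λ y → from u y < from u c) (sym eq) Pk<Pc)

        -- The last label before z that lies left of z is the root of the left subtree of z, so the
        -- whole left subtree descends from it.
        left-child-descendant : ∀ {x k} → x ≤ k → k < z → from u x < from u z → from u k < from u z →
                                (∀ c → k < c → c < z → from u z < from u c) →
                                Descendant u x z → Descendant u x k
        left-child-descendant {x} {k} x≤k k<z Px<Pz Pk<Pz after (_ , bound) = x≤k , λ where
            c (inj₂ (Pk<Pc , Pc<Px)) → ≮⇒≥ λ k<c → avoids-labels
              (≤∧≢⇒< x≤k λ eq → <-asym Pc<Px (subst (λ y → from u y < from u c) (sym eq) Pk<Pc))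
              k<c Pk<Pc Pc<Px
            c (inj₁ (Px<Pc , Pc<Pk)) → ≮⇒≥ λ k<c →
              let Pc<Pz = <-trans Pc<Pk Pk<Pz
                  c≢z = λ eq → <-irrefl (cong (from u) eq) Pc<Pz
              in <-asym Pc<Pz (after c k<c (≤∧≢⇒< (bound c (inj₁ (Px<Pc , Pc<Pz))) c≢z))

    -- Polish notation: the set of leaf labels determines the tree, by induction
    -- on the size of a postorder interval.
    descendants-unique : ∀ {Leaf} → (∀ y → Dec (Leaf y)) → ∀ m {u u′} → FullTree Leaf u → FullTree Leaf u′ →
                         ∀ {x z} → z < x + + m → Descendant u x z → Descendant u′ x z
    descendants-unique leaf? zero full full′ {x} {z} z<x (x≤z , _) =
      ⊥-elim (<⇒≱ (subst (z <_) (+-identityʳ x) z<x) x≤z)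
    descendants-unique {Leaf} leaf? (suc m) {u} {u′} full full′ {x} {z} z<x+1+m d@(x≤z , _) = go (x ≟ z) (leaf? z)
      where
      z≤x+m : z ≤ x + + m
      z≤x+m = <+1⇒≤ (subst (z <_) (eq x (+ m)) z<x+1+m)
        where
        eq : ∀ x m → x + (1ℤ + m) ≡ x + m + 1ℤ
        eq = solve-∀
      IH : ∀ {x′ z′} → x ≤ x′ → z′ < z → Descendant u x′ z′ → Descendant u′ x′ z′
      IH {x′} x≤x′ z′<z = descendants-unique leaf? m full full′
        (<-≤-trans z′<z (≤-trans z≤x+m (+-monoˡ-≤ (+ m) x≤x′)))
      IH′ : ∀ {x′ z′} → x ≤ x′ → z′ < z → Descendant u′ x′ z′ → Descendant u x′ z′
      IH′ {x′} x≤x′ z′<z = descendants-unique leaf? m full′ full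
        (<-≤-trans z′<z (≤-trans z≤x+m (+-monoˡ-≤ (+ m) x≤x′)))
      go : Dec (x ≡ z) → Dec (Leaf z) → Descendant u′ x z
      go (yes refl) _ = descendant-refl {u′}
      go (no x≢z) (yes leaf) = ⊥-elim (x≢z (leaf-descendant full leaf d))
      go (no x≢z) (no ¬leaf) = cases (<-cmp (from u x) (from u z))
        where
        x<z : x < z
        x<z = ≤∧≢⇒< x≤z x≢z
        inverted′ : ∀ {c} → x ≤ c → c < z → from u z < from u c → from u′ z < from u′ c
        inverted′ x≤c c<z inv = right⇒inverted full′ ¬leaf (IH x≤c (i-1<i z) (inverted⇒right full ¬leaf c<z inv))
        inverted : ∀ {c} → x ≤ c → c < z → from u′ z < from u′ c → from u z < from u c
        inverted x≤c c<z inv = right⇒inverted full ¬leaf (IH′ x≤c (i-1<i z) (inverted⇒right full′ ¬leaf c<z inv))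
        -- k is the left child of z. The induction hypothesis transfers the descent from k to x; k
        -- remains the left child in `u′` because the sides of z agree in both trees.
        through : ∃[ k ] x ≤ k × k ≤ z - 1ℤ × from u k < from u z × (∀ c → k < c → c ≤ z - 1ℤ → ¬ from u c < from u z) →
                  from u x < from u z → Descendant u′ x z
        through (k , x≤k , k≤z-1 , Pk<Pz , max) Px<Pz = descendant-trans {u′}
            (IH ≤-refl k<z (left-child-descendant full ¬leaf x≤k k<z Px<Pz Pk<Pz after d))
            (left-descendant full′ ¬leaf k<z P′k<P′z λ c k<c c<z → inverted′ (≤-trans x≤k (<⇒≤ k<c)) c<z (after c k<c c<z))
          where
          k<z : k < z
          k<z = ≤-<-trans k≤z-1 (i-1<i z)
          after : ∀ c → k < c → c < z → from u z < from u c
          after c k<c c<z = ≮∧≢⇒> (max c k<c (<⇒≤-1 c<z)) (λ eq → <-irrefl (from-injective u eq) c<z)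
          P′k<P′z : from u′ k < from u′ z
          P′k<P′z = ≮∧≢⇒> (λ inv → <-asym Pk<Pz (inverted x≤k k<z inv)) (λ eq → <-irrefl (sym (from-injective u′ eq)) k<z)
        cases : _ → Descendant u′ x z
        cases (tri≈ _ eq _)    = ⊥-elim (x≢z (from-injective u eq))
        cases (tri> _ _ Pz<Px) = inverted⇒descendant full′ ¬leaf x<z (inverted′ ≤-refl x<z Pz<Px)
        cases (tri< Px<Pz _ _) = through (greatest (λ k → from u k <? from u z) (<⇒≤-1 x<z) Px<Pz) Px<Pz

    module _ {Leaf : ℤ → Set} (leaf? : ∀ y → Dec (Leaf y)) {u u′ : AP}
             (full : FullTree Leaf u) (full′ : FullTree Leaf u′) where

      private
        transfer : ∀ {v v′} → FullTree Leaf v → FullTree Leaf v′ → ∀ {x z} → Descendant v x z → Descendant v′ x z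
        transfer f f′ {x} {z} d with ≤⇒∃+ (proj₁ d)
        ... | m , eq = descendants-unique leaf? (suc m) f f′ (subst (_< x + + suc m) (sym eq) (+-monoʳ-< x (+<+ ℕ.≤-refl))) d

        inner : ∀ {v x z} → FullTree Leaf v → x < z → Descendant v x z → ¬ Leaf z
        inner f x<z d leaf = <-irrefl (leaf-descendant f leaf d) x<z

        inverted-transfer : ∀ {v v′} → FullTree Leaf v → FullTree Leaf v′ →
                            ∀ {x z} → x < z → from v z < from v x → from v′ z < from v′ x
        inverted-transfer {v} {v′} f f′ {x} {z} x<z inv = case leaf? z of λ where
          (no ¬leaf) → right⇒inverted f′ ¬leaf (transfer f f′ (inverted⇒right f ¬leaf x<z inv))
          (yes leaf) → ⊥-elim (<-irrefl (leaf-descendant f leaf (<⇒≤ x<z , λ where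
            c (inj₁ (Px<Pc , Pc<Pz)) → ⊥-elim (<-asym inv (<-trans Px<Pc Pc<Pz))
            c (inj₂ (Pz<Pc , Pc<Px)) → ≮⇒≥ λ z<c → avoids-labels f x<z z<c Pz<Pc Pc<Px)) x<z)

      -- Which of two labels comes first in-order is decided by descendants, hence alike in both
      -- trees, so `u′⁻¹ ∘ u` is increasing.
      fullTree-unique : u ≈ u′
      fullTree-unique x = trans (sym (to-from u′ (to u x))) (cong (to u′) (increasing⇒id (u′ ⁻¹ᵃ ∘ᵃ u) increasing x))
        where
        increasing : ∀ {i j} → i < j → from u′ (to u i) < from u′ (to u j)
        increasing {i} {j} i<j with <-cmp (to u i) (to u j)
        ... | tri≈ _ eq _ = ⊥-elim (<-irrefl (to-injective u eq) i<j)
        ... | tri> _ _ gt = inverted-transfer full full′ gt (subst₂ _<_ (sym (from-to u i)) (sym (from-to u j)) i<j)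
        ... | tri< lt _ _ = ≮∧≢⇒>
          (λ inv → <-asym i<j (subst₂ _<_ (from-to u j) (from-to u i) (inverted-transfer full′ full lt inv)))
          (λ eq → <-irrefl (sym (from-injective u′ eq)) lt)

    -- Cycling blocks of positions

    offset-≡ : ∀ {p d e} → p + + e ≋ p + + d → + d ≤ + e → e ℕ.< n → e ≡ d
    offset-≡ {p} {d} {e} eq d≤e e<n = +-injective (+-cancelˡ (≋∧close⇒≡ eq (+-monoʳ-≤ p d≤e)
        (<-≤-trans (+-monoʳ-< p (+<+ e<n)) (+-monoˡ-≤ N (i≤i+j p (+ d))))))
      where
      eq₂ : ∀ p e → e ≡ p + e - p
      eq₂ = solve-∀
      +-cancelˡ : ∀ {e d} → p + e ≡ p + d → e ≡ d
      +-cancelˡ {e} {d} eq = trans (eq₂ p e) (trans (cong (λ z → z - p) eq) (sym (eq₂ p d)))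

    offset-unique : ∀ {x p d e} → x ≋ p → x + + d ≋ p + + e → d ℕ.< n → e ℕ.< n → d ≡ e
    offset-unique {x} {p} {d} {e} x≋p x+d≋p+e d<n e<n with ≤-total (+ d) (+ e)
    ... | inj₁ d≤e = sym (offset-≡ {p} (≋-trans (≋-sym x+d≋p+e) (≋-+ (+ d) x≋p)) d≤e e<n)
    ... | inj₂ e≤d = offset-≡ {p} (≋-trans (≋-sym (≋-+ (+ d) x≋p)) x+d≋p+e) e≤d d<n

    offset-base : ∀ a p → ∃[ x ] ∃[ d ] (d ℕ.< n × x ≋ p × a ≡ x + + d)
    offset-base a p with offset a p
    ... | d , d<n , a≋p+d = a - + d , d , d<n ,
      subst (a - + d ≋_) (i+j-j≡i p (+ d)) (≋-+ (- + d) a≋p+d) , sym (i-j+j≡i a (+ d))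

    -- On each translate of the block from p to p + m the last entry goes to the front and the
    -- others move up by one. As a product of adjacent transpositions it is affine by construction.
    cycleᵃ : ℤ → ℕ → AP
    cycleᵃ p zero    = idᵃ
    cycleᵃ p (suc m) = cycleᵃ p m ∘ᵃ adjᵃ (p + + m)

    module _ {p x : ℤ} (x≋p : x ≋ p) where

      private
        adj-fixed : ∀ {m d} → suc m ℕ.< n → d ℕ.< n → d ≢ m → d ≢ suc m → adj (p + + m) (x + + d) ≡ x + + d
        adj-fixed {m} {d} 1+m<n d<n d≢m d≢1+m = adj-unique (fixed
          (λ eq → d≢m (offset-unique x≋p eq d<n (ℕ.<-trans ℕ.≤-refl 1+m<n)))
          (λ eq → d≢1+m (offset-unique x≋p (subst (x + + d ≋_) (i+m+1≡i+[1+m] p m) eq) d<n 1+m<n)))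

      mutual
        cycle-block : ∀ {m d} → m ℕ.< n → d ℕ.< m → to (cycleᵃ p m) (x + + d) ≡ x + + suc d
        cycle-block {suc m} {d} 1+m<n d<1+m with d ℕ.≟ m
        ... | yes refl = trans (cong (to (cycleᵃ p m)) (trans (adj-unique (up (≋-+ (+ m) x≋p))) (i+m+1≡i+[1+m] x m)))
                               (cycle-fixed (ℕ.<-trans ℕ.≤-refl 1+m<n) ℕ.≤-refl 1+m<n)
        ... | no d≢m = trans (cong (to (cycleᵃ p m)) (adj-fixed 1+m<n (ℕ.<-trans d<1+m 1+m<n) d≢m (ℕ.<⇒≢ d<1+m)))
                             (cycle-block (ℕ.<-trans ℕ.≤-refl 1+m<n) (ℕ.≤∧≢⇒< (ℕ.s≤s⁻¹ d<1+m) d≢m))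

        cycle-last : ∀ {m} → m ℕ.< n → to (cycleᵃ p m) (x + + m) ≡ x
        cycle-last {zero}  m<n = +-identityʳ x
        cycle-last {suc m} 1+m<n = trans
          (cong (to (cycleᵃ p m)) (trans (cong (adj (p + + m)) (sym (i+m+1≡i+[1+m] x m)))
            (trans (adj-unique (down (≋-+ 1ℤ (≋-+ (+ m) x≋p)))) (i+1-1≡i (x + + m)))))
          (cycle-last (ℕ.<-trans ℕ.≤-refl 1+m<n))

        cycle-fixed : ∀ {m d} → m ℕ.< n → m ℕ.< d → d ℕ.< n → to (cycleᵃ p m) (x + + d) ≡ x + + d
        cycle-fixed {zero}  m<n m<d d<n = refl
        cycle-fixed {suc m} m<n m<d d<n = trans
          (cong (to (cycleᵃ p m)) (adj-fixed m<n d<n (ℕ.>⇒≢ (ℕ.<-trans ℕ.≤-refl m<d)) (ℕ.>⇒≢ m<d)))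
          (cycle-fixed (ℕ.<-trans ℕ.≤-refl m<n) (ℕ.<-trans ℕ.≤-refl m<d) d<n)

    module _ (p : ℤ) {m : ℕ} (m<n : m ℕ.< n) where

      private
        κ : AP
        κ = cycleᵃ p m

        from-κ : ∀ {x y} → to κ x ≡ y → from κ y ≡ x
        from-κ {x} eq = trans (cong (from κ) (sym eq)) (from-to κ x)

        d≡0 : ∀ {x d} → x ≋ p → d ℕ.< n → x + + d ≋ p → d ≡ 0
        d≡0 x≋p d<n eq = offset-unique x≋p (≋-trans eq (≋-reflexive (sym (+-identityʳ p)))) d<n (ℕ.≤-trans (s≤s z≤n) d<n)

      -- The inverse cycle moves the first entry of each block [x , x + m] to the end.
      data Unshift (a : ℤ) : ℤ → Set where
        jump : a ≋ p → Unshift a (a + + m)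
        back : ¬ a ≋ p → Unshift a (a - 1ℤ)
        stay : ¬ a ≋ p → Unshift a a

      unshift : ∀ a → Unshift a (from κ a)
      unshift a with offset-base a p
      ... | x , zero , d<n , x≋p , refl = subst (Unshift (x + 0ℤ))
            (trans (cong (λ z → z + + m) (+-identityʳ x)) (sym (trans (cong (from κ) (+-identityʳ x)) (from-κ (cycle-last x≋p m<n)))))
            (jump (subst (_≋ p) (sym (+-identityʳ x)) x≋p))
      ... | x , suc d , d<n , x≋p , refl with d ℕ.<? m
      ...   | yes d<m = subst (Unshift (x + + suc d))
              (trans (cong (λ z → z - 1ℤ) (sym (i+m+1≡i+[1+m] x d))) (trans (i+1-1≡i (x + + d)) (sym (from-κ (cycle-block x≋p m<n d<m)))))
              (back λ eq → case d≡0 x≋p d<n eq of λ ())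
      ...   | no d≮m = subst (Unshift (x + + suc d))
              (sym (from-κ (cycle-fixed x≋p m<n (s≤s (ℕ.≮⇒≥ d≮m)) d<n)))
              (stay λ eq → case d≡0 x≋p d<n eq of λ ())

      unshift-block : ∀ {x y} → x ≋ p → x < y → y ≤ x + + m → from κ y ≡ y - 1ℤ
      unshift-block {x} {y} x≋p x<y y≤x+m with ≤⇒∃+ (<⇒+1≤ x<y)
      ... | d , refl = trans (cong (from κ) (i+1+m≡i+[1+m] x (+ d)))
            (trans (from-κ (cycle-block x≋p m<n d<m)) (eq x (+ d)))
        where
        eq : ∀ x d → x + d ≡ x + 1ℤ + d - 1ℤ
        eq = solve-∀
        eq′ : ∀ x d m → x + m - (x + 1ℤ + d) ≡ m - (1ℤ + d)
        eq′ = solve-∀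
        d<m : d ℕ.< m
        d<m = drop‿+≤+ (≤-difference y≤x+m (eq′ x (+ d) (+ m)))

      data Shift (a : ℤ) : ℤ → Set where
        jump : a ≋ p + + m → Shift a (a - + m)
        forth : ¬ a ≋ p + + m → Shift a (a + 1ℤ)
        stay : ¬ a ≋ p + + m → Shift a a

      shift : ∀ a → Shift a (to κ a)
      shift a with offset-base a p
      ... | x , d , d<n , x≋p , refl with ℕ.<-cmp d m
      ...   | tri< d<m d≢m _ = subst (Shift (x + + d)) (trans (i+m+1≡i+[1+m] x d) (sym (cycle-block x≋p m<n d<m)))
                                 (forth λ eq → d≢m (offset-unique x≋p eq d<n m<n))
      ...   | tri≈ _ refl _  = subst (Shift (x + + m)) (trans (i+j-j≡i x (+ m)) (sym (cycle-last x≋p m<n)))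
                                 (jump (≋-+ (+ m) x≋p))
      ...   | tri> _ d≢m m<d = subst (Shift (x + + d)) (sym (cycle-fixed x≋p m<n m<d d<n))
                                 (stay λ eq → d≢m (offset-unique x≋p eq d<n m<n))

      shift-block : ∀ {x y} → y ≋ p + + m → y - + m ≤ x → x < y → to κ x ≡ x + 1ℤ
      shift-block {x} {y} y≋p+m y-m≤x x<y with ≤⇒∃+ y-m≤x
      ... | d , refl = trans (cycle-block (subst (y - + m ≋_) (i+j-j≡i p (+ m)) (≋-+ (- + m) y≋p+m)) m<n d<m) (sym (i+m+1≡i+[1+m] (y - + m) d))
        where
        eq : ∀ y m d → y - (y - m + d) ≡ m - d
        eq = solve-∀
        d<m : d ℕ.< m
        d<m = drop‿+<+ (<-difference x<y (eq y (+ m) (+ d)))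

    -- `Flips` is the inversion set of `π`. This is all that the arguments about moved nodes use of
    -- the two cycles.
    record Rearrangement (Flips : ℤ → ℤ → Set) (π : AP) : Set where
      field
        flips⇒< : ∀ {x y} → Flips x y → x < y
        flips   : ∀ {x y} → Flips x y → to π y < to π x
        keeps   : ∀ {x y} → x < y → to π x < to π y ⊎ Flips x y

      reflects : ∀ {x y} → to π x < to π y → x < y ⊎ Flips y x
      reflects {x} {y} πx<πy with <-cmp x y
      ... | tri< x<y _ _ = inj₁ x<y
      ... | tri≈ _ refl _ = ⊥-elim (<-irrefl refl πx<πy)
      ... | tri> _ _ y<x with keeps y<x
      ...   | inj₁ πy<πx = ⊥-elim (<-asym πx<πy πy<πx)
      ...   | inj₂ f     = inj₂ f

    module _ (p : ℤ) {m : ℕ} (m<n : m ℕ.< n) where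

      FlipRight : ℤ → ℤ → Set
      FlipRight x y = x ≋ p × x < y × y ≤ x + + m

      -- Every entry moves down by at most one, except that the jumping entries go up by m. So order
      -- is weakly kept outside the flips, and injectivity makes it strict.
      unshift-rearrangement : Rearrangement FlipRight (cycleᵃ p m ⁻¹ᵃ)
      unshift-rearrangement = record
        { flips⇒< = λ (_ , x<y , _) → x<y
        ; flips   = λ {x} {y} (x≋p , x<y , y≤x+m) → subst₂ _<_
            (sym (unshift-block p m<n x≋p x<y y≤x+m)) (sym (π-jump x≋p (unshift p m<n x)))
            (<-≤-trans (i-1<i y) y≤x+m)
        ; keeps   = λ {x} {y} x<y → case x ≋? p of λ where
            (no x≋̸p) → inj₁ (≤∧≢⇒< (≤-trans (π≤ x≋̸p (unshift p m<n x)) (≤-trans (<⇒≤-1 x<y) (π≥ (unshift p m<n y))))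
                              (distinct x<y))
            (yes x≋p) → case y ≤? x + + m of λ where
              (yes y≤x+m) → inj₂ (x≋p , x<y , y≤x+m)
              (no y≰x+m)  → inj₁ (≤∧≢⇒< (subst (_≤ from (cycleᵃ p m) y) (sym (π-jump x≋p (unshift p m<n x)))
                                         (≤-trans (<⇒≤-1 (≰⇒> y≰x+m)) (π≥ (unshift p m<n y))))
                                  (distinct x<y))
        }
        where
        distinct : ∀ {x y} → x < y → from (cycleᵃ p m) x ≢ from (cycleᵃ p m) y
        distinct x<y eq = <-irrefl (from-injective (cycleᵃ p m) eq) x<y
        π-jump : ∀ {x y} → x ≋ p → Unshift p m<n x y → y ≡ x + + m
        π-jump x≋p (jump _)    = refl
        π-jump x≋p (back x≋̸p) = ⊥-elim (x≋̸p x≋p)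
        π-jump x≋p (stay x≋̸p) = ⊥-elim (x≋̸p x≋p)
        π≤ : ∀ {x y} → ¬ x ≋ p → Unshift p m<n x y → y ≤ x
        π≤ x≋̸p (jump x≋p) = ⊥-elim (x≋̸p x≋p)
        π≤ _   (back _)   = <⇒≤ (i-1<i _)
        π≤ _   (stay _)   = ≤-refl
        π≥ : ∀ {x y} → Unshift p m<n x y → x - 1ℤ ≤ y
        π≥ {x} (jump _) = ≤-trans (<⇒≤ (i-1<i x)) (i≤i+j x (+ m))
        π≥     (back _) = ≤-refl
        π≥ {x} (stay _) = <⇒≤ (i-1<i x)

      FlipLeft : ℤ → ℤ → Set
      FlipLeft x y = y ≋ p + + m × y - + m ≤ x × x < y

      shift-rearrangement : Rearrangement FlipLeft (cycleᵃ p m)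
      shift-rearrangement = record
        { flips⇒< = λ (_ , _ , x<y) → x<y
        ; flips   = λ {x} {y} (y≋ , y-m≤x , x<y) → subst₂ _<_
            (sym (π-jump y≋ (shift p m<n y))) (sym (shift-block p m<n y≋ y-m≤x x<y))
            (≤⇒<+1 y-m≤x)
        ; keeps   = λ {x} {y} x<y → case y ≋? p + + m of λ where
            (no y≋̸) → inj₁ (≤∧≢⇒< (≤-trans (π≤ (shift p m<n x)) (≤-trans (<⇒+1≤ x<y) (π≥ y≋̸ (shift p m<n y))))
                             (distinct x<y))
            (yes y≋) → case y - + m ≤? x of λ where
              (yes y-m≤x) → inj₂ (y≋ , y-m≤x , x<y)
              (no y-m≰x)  → inj₁ (≤∧≢⇒< (subst (to (cycleᵃ p m) x ≤_) (sym (π-jump y≋ (shift p m<n y)))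
                                         (≤-trans (π≤ (shift p m<n x)) (<⇒+1≤ (≰⇒> y-m≰x))))
                                  (distinct x<y))
        }
        where
        distinct : ∀ {x y} → x < y → to (cycleᵃ p m) x ≢ to (cycleᵃ p m) y
        distinct x<y eq = <-irrefl (to-injective (cycleᵃ p m) eq) x<y
        π-jump : ∀ {x y} → x ≋ p + + m → Shift p m<n x y → y ≡ x - + m
        π-jump x≋ (jump _)    = refl
        π-jump x≋ (forth x≋̸) = ⊥-elim (x≋̸ x≋)
        π-jump x≋ (stay x≋̸)  = ⊥-elim (x≋̸ x≋)
        π≤ : ∀ {x y} → Shift p m<n x y → y ≤ x + 1ℤ
        π≤ {x} (jump _)  = ≤-trans (i-j≤i x (+ m)) (<⇒≤ (i<i+1 x))
        π≤     (forth _) = ≤-refl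
        π≤ {x} (stay _)  = <⇒≤ (i<i+1 x)
        π≥ : ∀ {x y} → ¬ x ≋ p + + m → Shift p m<n x y → x ≤ y
        π≥ x≋̸ (jump x≋)  = ⊥-elim (x≋̸ x≋)
        π≥ {x} _ (forth _) = <⇒≤ (i<i+1 x)
        π≥ _   (stay _)  = ≤-refl

    -- Moving a node of the tree

    module _ (u : AP) where

      shift-< : ∀ k {a b} → to u a < to u b → to u (a + k * N) < to u (b + k * N)
      shift-< k {a} {b} lt = subst₂ _<_ (sym (to-+ u k a)) (sym (to-+ u k b)) (+-monoˡ-< (k * N) lt)

      shift-≤ : ∀ k {a b} → to u a ≤ to u b → to u (a + k * N) ≤ to u (b + k * N)
      shift-≤ k {a} {b} le = subst₂ _≤_ (sym (to-+ u k a)) (sym (to-+ u k b)) (+-monoˡ-≤ (k * N) le)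

      shift-Bel : ∀ k {a b} → Bel (to u) a b → Bel (to u) (a + k * N) (b + k * N)
      shift-Bel k {a} {b} (le , bound) = shift-≤ k le , λ c btw →
        subst (λ z → to u z ≤ to u (b + k * N)) (i-j+j≡i c (k * N)) (shift-≤ k (bound (c - k * N) (unshifted btw)))
        where
        eq₁ : ∀ a c z → c - (a + z) ≡ c - z - a
        eq₁ = solve-∀
        eq₂ : ∀ b c z → b + z - c ≡ b - (c - z)
        eq₂ = solve-∀
        unshifted : ∀ {c} → Between (a + k * N) c (b + k * N) → Between a (c - k * N) b
        unshifted {c} (inj₁ (l , r)) = inj₁ (<-difference l (eq₁ a c (k * N)) , <-difference r (eq₂ b c (k * N)))
        unshifted {c} (inj₂ (l , r)) = inj₂ (<-difference l (eq₁ b c (k * N)) , <-difference r (eq₂ a c (k * N)))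

    module _ {w u : AP} {π : AP}
      (avoids : ∀ {x y z} → to π x < to π y → to π y < to π z → to u z < to u x → to u x < to u y → ⊥)
      (decreasing : ∀ {x y} → to u x ≤ to u y →
                    (∀ c → Between (to π x) (to π c) (to π y) → to u c ≤ to u y) → to w (to u x) ≤ to w (to u y))
      where

      -- The hypotheses describe the new tree by the old positions of its nodes: a node keeps its
      -- label and goes from x to `to π x`.
      rearranged-valid : Valid w (u ∘ᵃ π ⁻¹ᵃ)
      rearranged-valid = valid
        (λ i<j j<k → avoids (subst₂ _<_ (sym (to-from π _)) (sym (to-from π _)) i<j)
                            (subst₂ _<_ (sym (to-from π _)) (sym (to-from π _)) j<k))
        (λ {i} {j} (le , bound) → decreasing le λ c btw →
          subst (λ z → to u z ≤ to u (from π j)) (from-to π c)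
            (bound (to π c) (subst₂ (λ a b → Between a (to π c) b) (to-from π i) (to-from π j) btw)))

    rearranged-≉ : ∀ {F π} → Rearrangement F π → ∀ {x y} → F x y → ∀ u → ¬ u ∘ᵃ π ⁻¹ᵃ ≈ u
    rearranged-≉ {F} {π} r {x} {y} f u eq = <-asym (flips⇒< f) (subst₂ _<_ (fix y) (fix x) (flips f))
      where
      open Rearrangement r
      fix : ∀ z → to π z ≡ z
      fix z = trans (cong (to π) (sym (to-injective u (eq z)))) (to-from π z)

    module _ {w u : AP} (val : Valid w u) where
      open Valid val

      -- The node at p jumps right over its right subtree p + 1 , … , p + m.
      module JumpRight (p : ℤ) {m : ℕ} (0<m : 0 ℕ.< m) (m<n : m ℕ.< n)
        (subtree-p : ∀ c → p < c → c ≤ p + + m → to u c < to u p)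
        (after-p : to u p < to u (p + + m + 1ℤ))
        -- After the jump the left subtree of p hangs below the node at p + 1, the leftmost one of
        -- the right subtree, so `w` has to decrease there.
        (attach-p : ∀ a → a < p → Bel (to u) a p → to w (to u a) < to w (to u (p + 1ℤ)))
        where

        private
          r : Rearrangement (FlipRight p m<n) (cycleᵃ p m ⁻¹ᵃ)
          r = unshift-rearrangement p m<n
          open Rearrangement r
          π : AP
          π = cycleᵃ p m ⁻¹ᵃ
          F : ℤ → ℤ → Set
          F = FlipRight p m<n

          subtree : ∀ {x c} → F x c → to u c < to u x
          subtree {c = c} (multiple k refl , x<c , c≤x+m) = subst (λ z → to u z < to u (p + k * N)) (i-j+j≡i c (k * N))
            (shift-< u k (subtree-p (c - k * N) (<-difference x<c (eq₁ p c (k * N))) (≤-difference c≤x+m (eq₂ p c (k * N) (+ m)))))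
            where
            eq₁ : ∀ p c z → c - (p + z) ≡ c - z - p
            eq₁ = solve-∀
            eq₂ : ∀ p c z m → p + z + m - c ≡ p + m - (c - z)
            eq₂ = solve-∀

          after : ∀ {x} → x ≋ p → to u x < to u (x + + m + 1ℤ)
          after (multiple k refl) = subst (λ z → to u (p + k * N) < to u z) (eq p (k * N) (+ m)) (shift-< u k after-p)
            where
            eq : ∀ p z m → p + m + 1ℤ + z ≡ p + z + m + 1ℤ
            eq = solve-∀

          attach : ∀ {x a} → x ≋ p → a < x → Bel (to u) a x → to w (to u a) < to w (to u (x + 1ℤ))
          attach {a = a} (multiple k refl) a<x b = subst₂ (λ y z → to w (to u y) < to w (to u z))
            (i-j+j≡i a (k * N)) (eq₃ p (k * N))
            (subst₂ (λ y z → to w y < to w z) (sym (to-+ u k _)) (sym (to-+ u k _))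
              (shift-< w k (attach-p (a - k * N) (<-difference a<x (eq₁ a p (k * N))) b′)))
            where
            eq₁ : ∀ a p z → p + z - a ≡ p - (a - z)
            eq₁ = solve-∀
            eq₂ : ∀ a k N → a + - k * N ≡ a - k * N
            eq₂ = solve-∀
            eq₃ : ∀ p z → p + 1ℤ + z ≡ p + z + 1ℤ
            eq₃ = solve-∀
            b′ : Bel (to u) (a - k * N) p
            b′ = subst₂ (Bel (to u)) (eq₂ a k N) (trans (eq₂ (p + k * N) k N) (i+j-j≡i p (k * N))) (shift-Bel u (- k) b)

          disjoint : ∀ {x y d} → F x y → F d y → x < d → ⊥
          disjoint {x} {y} {d} (x≋p , _ , y≤x+m) (d≋p , d<y , _) x<d =
            <-irrefl (sym (≋∧close⇒≡ (≋-trans d≋p (≋-sym x≋p)) (<⇒≤ x<d)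
              (<-≤-trans d<y (≤-trans y≤x+m (+-monoʳ-≤ x (+≤+ (ℕ.<⇒≤ m<n))))))) x<d

          avoids′ : ∀ {x y z} → to π x < to π y → to π y < to π z → to u z < to u x → to u x < to u y → ⊥
          avoids′ {x} {y} {z} πx<πy πy<πz uz<ux ux<uy with reflects πy<πz | reflects (<-trans πx<πy πy<πz) | reflects πx<πy
          ... | inj₂ f | _ | _ = <-asym (<-trans uz<ux ux<uy) (subtree f)
          ... | inj₁ _ | inj₂ f | _ = <-asym uz<ux (subtree f)
          ... | inj₁ y<z | inj₁ _ | inj₁ x<y = avoids x<y y<z uz<ux ux<uy
          -- The node y has jumped over x. The position just after its right subtree has a larger
          -- label and replaces y as the peak of the pattern.
          ... | inj₁ y<z | inj₁ _ | inj₂ (y≋p , y<x , x≤y+m) =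
            avoids {x} {y + + m + 1ℤ} {z} (≤⇒<+1 x≤y+m) (≤∧≢⇒< (<⇒+1≤ y+m<z) next≢z) uz<ux (<-trans ux<uy (after y≋p))
            where
            y+m<z : y + + m < z
            y+m<z = ≰⇒> λ z≤y+m → <-asym πy<πz (flips (y≋p , y<z , z≤y+m))
            next≢z : y + + m + 1ℤ ≢ z
            next≢z refl = <-asym (<-trans uz<ux ux<uy) (after y≋p)

          decreasing′ : ∀ {x y} → to u x ≤ to u y →
                        (∀ c → Between (to π x) (to π c) (to π y) → to u c ≤ to u y) → to w (to u x) ≤ to w (to u y)
          decreasing′ {x} {y} ux≤uy bound with x ≟ y
          ... | yes refl = ≤-refl
          ... | no  x≢y  = ≮⇒≥ λ vy<vx → <⇒≱ vy<vx (decreasing (ux≤uy , λ c btw → ≮⇒≥ λ uy<uc → absurd vy<vx c uy<uc btw))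
            where
            ux<uy : to u x < to u y
            ux<uy = ≤∧≢⇒< ux≤uy (x≢y ∘ to-injective u)
            πx<π : ∀ {d} → x < d → to u y < to u d → to π x < to π d
            πx<π x<d uy<ud with keeps x<d
            ... | inj₁ lt = lt
            ... | inj₂ f  = ⊥-elim (<-asym (<-trans ux<uy uy<ud) (subtree f))
            absurd : to w (to u y) < to w (to u x) → ∀ c → to u y < to u c → Between x c y → ⊥
            absurd vy<vx c uy<uc (inj₂ (y<c , c<x)) = avoids y<c c<x ux<uy uy<uc
            absurd vy<vx c uy<uc (inj₁ (x<c , c<y)) with keeps c<y
            ... | inj₁ πc<πy = <⇒≱ uy<uc (bound c (inj₁ (πx<π x<c uy<uc , πc<πy)))
            -- The node c separated x from y and has jumped over y. So x comes from its left
            -- subtree, y lies above c + 1 in its right subtree, and `attach` joins the two.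
            ... | inj₂ f@(c≋p , _ , _) = <-asym vy<vx (<-≤-trans (attach c≋p x<c x-below-c) (decreasing c+1-below-y))
              where
              right-of-c : ∀ d → c < d → d ≤ y → to u d ≤ to u y
              right-of-c d c<d d≤y with d ≟ y
              ... | yes refl = ≤-refl
              ... | no  d≢y  = ≮⇒≥ λ uy<ud → case keeps (≤∧≢⇒< d≤y d≢y) of λ where
                (inj₁ πd<πy) → <⇒≱ uy<ud (bound d (inj₁ (πx<π (<-trans x<c c<d) uy<ud , πd<πy)))
                (inj₂ f′)    → disjoint f f′ c<d
              x-below-c : Bel (to u) x c
              x-below-c = <⇒≤ (<-trans ux<uy uy<uc) , λ where
                d (inj₂ (c<d , d<x)) → ⊥-elim (<-asym x<c (<-trans c<d d<x))
                d (inj₁ (x<d , d<c)) → ≮⇒≥ λ uc<ud → case keeps (<-trans d<c c<y) of λ where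
                  (inj₁ πd<πy) → <⇒≱ (<-trans uy<uc uc<ud) (bound d (inj₁ (πx<π x<d (<-trans uy<uc uc<ud) , πd<πy)))
                  (inj₂ f′)    → disjoint f′ f d<c
              c+1-below-y : Bel (to u) (c + 1ℤ) y
              c+1-below-y = right-of-c _ (i<i+1 c) (<⇒+1≤ c<y) , λ where
                d (inj₁ (c+1<d , d<y)) → right-of-c d (<-trans (i<i+1 c) c+1<d) (<⇒≤ d<y)
                d (inj₂ (y<d , d<c+1)) → ⊥-elim (<⇒≱ c<y (<⇒≤ (<-≤-trans y<d (<+1⇒≤ d<c+1))))

        jump-right : ∃[ u′ ] (Valid w u′ × ¬ u′ ≈ u)
        jump-right = u ∘ᵃ π ⁻¹ᵃ , rearranged-valid {w} {u} {π} avoids′ decreasing′ ,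
          rearranged-≉ r {p} {p + 1ℤ} (≋-refl , i<i+1 p , +-monoʳ-≤ p (+≤+ 0<m)) u

      -- The node at b + m, with left child b and no right child, jumps left over
      -- that child and its right subtree.
      module JumpLeft (b : ℤ) {m : ℕ} (0<m : 0 ℕ.< m) (m<n : m ℕ.< n)
        -- Without a right subtree in between, a left child immediately precedes its parent in
        -- postorder.
        (successor-b : to u (b + + m) ≡ to u b + 1ℤ)
        (subtree-b : ∀ c → b < c → c < b + + m → to u c < to u b)
        where

        private
          r : Rearrangement (FlipLeft b m<n) (cycleᵃ b m)
          r = shift-rearrangement b m<n
          open Rearrangement r
          π : AP
          π = cycleᵃ b m
          F : ℤ → ℤ → Set
          F = FlipLeft b m<n

          successor : ∀ {y} → y ≋ b + + m → to u y ≡ to u (y - + m) + 1ℤ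
          successor (multiple k refl) = begin
            to u (b + + m + k * N)              ≡⟨ to-+ u k (b + + m) ⟩
            to u (b + + m) + k * N              ≡⟨ cong (λ z → z + k * N) successor-b ⟩
            to u b + 1ℤ + k * N                 ≡⟨ eq₁ (to u b) (k * N) ⟩
            to u b + k * N + 1ℤ                 ≡⟨ cong (λ z → z + 1ℤ) (to-+ u k b) ⟨
            to u (b + k * N) + 1ℤ               ≡⟨ cong (λ z → to u z + 1ℤ) (eq₂ b (k * N) (+ m)) ⟩
            to u (b + + m + k * N - + m) + 1ℤ   ∎
            where
            open ≡-Reasoning
            eq₁ : ∀ a z → a + 1ℤ + z ≡ a + z + 1ℤ
            eq₁ = solve-∀
            eq₂ : ∀ b z m → b + z ≡ b + m + z - m
            eq₂ = solve-∀

          subtree : ∀ {y c} → y ≋ b + + m → y - + m < c → c < y → to u c < to u (y - + m)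
          subtree {c = c} (multiple k refl) y-m<c c<y = subst₂ (λ d e → to u d < to u e)
            (i-j+j≡i c (k * N)) (eq₃ b (k * N) (+ m))
            (shift-< u k (subtree-b (c - k * N) (<-difference y-m<c (eq₁ b c (k * N) (+ m))) (<-difference c<y (eq₂ (b + + m) c (k * N)))))
            where
            eq₁ : ∀ b c z m → c - (b + m + z - m) ≡ c - z - b
            eq₁ = solve-∀
            eq₂ : ∀ b c z → b + z - c ≡ b - (c - z)
            eq₂ = solve-∀
            eq₃ : ∀ b z m → b + z ≡ b + m + z - m
            eq₃ = solve-∀

          between-labels : ∀ {y a} → y ≋ b + + m → to u a < to u y → to u a ≤ to u (y - + m)
          between-labels y≋ lt = <+1⇒≤ (subst (to u _ <_) (successor y≋) lt)

          flipped-< : ∀ {x y} → F x y → to u x < to u y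
          flipped-< {x} {y} (y≋ , y-m≤x , x<y) with y - + m ≟ x
          ... | yes refl = subst (to u (y - + m) <_) (sym (successor y≋)) (i<i+1 _)
          ... | no  neq  = <-trans (subtree y≋ (≤∧≢⇒< y-m≤x neq) x<y) (subst (to u (y - + m) <_) (sym (successor y≋)) (i<i+1 _))

          avoids′ : ∀ {x y z} → to π x < to π y → to π y < to π z → to u z < to u x → to u x < to u y → ⊥
          avoids′ {x} {y} {z} πx<πy πy<πz uz<ux ux<uy with reflects πx<πy | reflects πy<πz
          ... | inj₂ f | _ = <-asym ux<uy (flipped-< f)
          ... | inj₁ x<y | inj₁ y<z = avoids x<y y<z uz<ux ux<uy
          -- The node y has jumped over z. Its old left child at y - m, with label one smaller,
          -- replaces it as the peak.
          ... | inj₁ x<y | inj₂ (y≋ , y-m≤z , z<y) =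
            avoids x<y-m (≤∧≢⇒< y-m≤z y-m≢z) uz<ux
              (≤∧≢⇒< (between-labels y≋ ux<uy) λ eq → <-irrefl (to-injective u eq) x<y-m)
            where
            x<y-m : x < y - + m
            x<y-m = ≰⇒> λ y-m≤x → <-asym πx<πy (flips (y≋ , y-m≤x , x<y))
            y-m≢z : y - + m ≢ z
            y-m≢z refl = <⇒≱ uz<ux (between-labels y≋ ux<uy)

          -- No ancestor pair is new: the left subtree of b passes directly to the node that jumped,
          -- which was above it before.
          decreasing′ : ∀ {x y} → to u x ≤ to u y →
                        (∀ c → Between (to π x) (to π c) (to π y) → to u c ≤ to u y) → to w (to u x) ≤ to w (to u y)
          decreasing′ {x} {y} ux≤uy bound with x ≟ y
          ... | yes refl = ≤-refl
          ... | no  x≢y  = decreasing (ux≤uy , λ c btw → ≮⇒≥ λ uy<uc → absurd c uy<uc btw)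
            where
            ux<uy : to u x < to u y
            ux<uy = ≤∧≢⇒< ux≤uy (x≢y ∘ to-injective u)
            absurd : ∀ c → to u y < to u c → Between x c y → ⊥
            absurd c uy<uc (inj₂ (y<c , c<x)) = avoids y<c c<x ux<uy uy<uc
            absurd c uy<uc (inj₁ (x<c , c<y)) with keeps x<c | keeps c<y
            ... | inj₁ πx<πc | inj₁ πc<πy = <⇒≱ uy<uc (bound c (inj₁ (πx<πc , πc<πy)))
            ... | _ | inj₂ f = <-asym uy<uc (flipped-< f)
            ... | inj₂ (c≋ , c-m≤x , _) | inj₁ _ = avoids c-m<c c<y
                (≤∧≢⇒< (between-labels c≋ uy<uc) λ eq → <-asym c-m<c (subst (c <_) (to-injective u eq) c<y))
                (subst (to u (c - + m) <_) (sym (successor c≋)) (i<i+1 _))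
              where
              c-m<c : c - + m < c
              c-m<c = ≤-<-trans c-m≤x x<c

        jump-left : ∃[ u′ ] (Valid w u′ × ¬ u′ ≈ u)
        jump-left = u ∘ᵃ π ⁻¹ᵃ , rearranged-valid {w} {u} {π} avoids′ decreasing′ ,
          rearranged-≉ r {b} {b + + m} (≋-refl , ≤-reflexive (i+j-j≡i b (+ m)) ,
            subst (_< b + + m) (+-identityʳ b) (+-monoʳ-< b (+<+ 0<m))) u

    -- Fertility one

    module _ {w u : AP} (val : Valid w u) where
      open Valid val

      jump-right-at : ∀ p → to u (p + 1ℤ) < to u p →
                      (∀ a → a < p → Bel (to u) a p → to w (to u a) < to w (to u (p + 1ℤ))) →
                      ∃[ u′ ] (Valid w u′ × ¬ u′ ≈ u)
      jump-right-at p descent attach =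
        -- The right subtree of p ends before the first larger label, which occurs at p + n at the
        -- latest; this keeps the jump shorter than n.
        go (least {λ t → to u p < to u t} (λ t → to u p <? to u t) (+-monoʳ-≤ p (<⇒≤ 1<N))
          (subst (to u p <_) (sym (AffinePermutation.periodic u p)) (i<i+N (to u p))))
        where
        go : ∃[ s ] p + 1ℤ ≤ s × s ≤ p + N × to u p < to u s × (∀ t → p + 1ℤ ≤ t → t < s → ¬ to u p < to u t) → _
        go (s , p+1≤s , s≤p+N , up<us , first) with ≤⇒∃+ p+1≤s
        ... | zero  , refl = ⊥-elim (<-asym descent (subst (λ z → to u p < to u z) (+-identityʳ (p + 1ℤ)) up<us))
        ... | suc m , refl = JumpRight.jump-right val p (s≤s z≤n) 1+m<n subtree
                               (subst (λ z → to u p < to u z) (eq₁ p (+ suc m)) up<us) attach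
          where
          eq₁ : ∀ p m → p + 1ℤ + m ≡ p + m + 1ℤ
          eq₁ = solve-∀
          eq₂ : ∀ p m N → p + N - (p + 1ℤ + m) ≡ N - (1ℤ + m)
          eq₂ = solve-∀
          1+m<n : suc m ℕ.< n
          1+m<n = drop‿+≤+ (≤-difference s≤p+N (eq₂ p (+ suc m) N))
          subtree : ∀ c → p < c → c ≤ p + + suc m → to u c < to u p
          subtree c p<c c≤ = ≮∧≢⇒> (first c (<⇒+1≤ p<c) (subst (c <_) (sym (eq₁ p (+ suc m))) (≤⇒<+1 c≤)))
                                   (λ eq → <-irrefl (to-injective u eq) p<c)

      -- The node p has a left child and no right child, so its predecessor b in postorder is that
      -- left child.
      jump-left-at : ∀ p → to u (p - 1ℤ) < to u p → to u p < to u (p + 1ℤ) → ∃[ u′ ] (Valid w u′ × ¬ u′ ≈ u)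
      jump-left-at p ascent ascent′ = go (≤⇒∃+ (<⇒≤ b<p)) b<p subtree refl
        where
        open Predecessor u p renaming (ub<uq to ub<up)
        b<p : b < p
        b<p = ascent⇒b<q avoids ascent′
        subtree : ∀ c → b < c → c < p → to u c < to u b
        subtree c b<c c<p = below-b (≮∧≢⇒> up≮uc (λ eq → <-irrefl (sym (to-injective u eq)) c<p)) (λ eq → <-irrefl (sym eq) b<c)
          where
          up≮uc : ¬ to u p < to u c
          up≮uc up<uc = avoids b<c c<p-1 (below-b ascent λ eq → <-irrefl (sym eq) (<-trans b<c c<p-1)) (<-trans ub<up up<uc)
            where
            c<p-1 : c < p - 1ℤ
            c<p-1 = ≤∧≢⇒< (<⇒≤-1 c<p) λ eq → <-asym up<uc (subst (λ z → to u z < to u p) (sym eq) ascent)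
        go : ∀ {p′} → ∃[ m ] p′ ≡ b + + m → b < p′ → (∀ c → b < c → c < p′ → to u c < to u b) → p′ ≡ p → _
        go (zero  , refl) b<p′ _ _ = ⊥-elim (<-irrefl (sym (+-identityʳ b)) b<p′)
        go (suc m , refl) b<p′ sub p′≡p = JumpLeft.jump-left val b (s≤s z≤n) (ℕ.≰⇒> n≰1+m)
            (trans (cong (to u) p′≡p) (trans (sym (i-1+1≡i (to u p))) (cong (λ z → z + 1ℤ) (sym ub)))) sub
          where
          eq : ∀ y N → y - 1ℤ + N - y ≡ N - 1ℤ
          eq = solve-∀
          -- The label at b + n is `to u b + n`: too large for the right subtree of b, and different
          -- from the label `to u b + 1` of p because 1 < n.
          n≰1+m : ¬ n ℕ.≤ suc m
          n≰1+m n≤1+m with n ℕ.≟ suc m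
          ... | no n≢1+m = <-asym (i<i+N (to u b)) (subst (_< to u b) (AffinePermutation.periodic u b)
                             (sub (b + N) (i<i+N b) (+-monoʳ-< b (+<+ (ℕ.≤∧≢⇒< n≤1+m n≢1+m)))))
          ... | yes n≡1+m = <-irrefl 1≡N 1<N
            where
            up≡ : to u p ≡ to u p - 1ℤ + N
            up≡ = trans (cong (to u) (trans (sym p′≡p) (cong (λ k → b + + k) (sym n≡1+m))))
                        (trans (AffinePermutation.periodic u b) (cong (λ z → z + N) ub))
            1≡N : 1ℤ ≡ N
            1≡N = sym (i-j≡0⇒i≡j N 1ℤ (trans (sym (eq (to u p) N))
                    (trans (cong (λ z → z - to u p) (sym up≡)) (+-inverseʳ (to u p)))))

      -- The leaf q = p + 1 is the first node visited in the right subtree of p. If p has a left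
      -- child, that child is b and everything in the left subtree descends from it. As the label of
      -- q does not follow a descent, `w` at q exceeds `w` on that subtree.
      valley⇒jump-right : ∀ p → to u (p + 1ℤ) < to u p → to u (p + 1ℤ) < to u (p + 1ℤ + 1ℤ) →
                          ¬ LeafAt w u (p + 1ℤ) → ∃[ u′ ] (Valid w u′ × ¬ u′ ≈ u)
      valley⇒jump-right p descent ascent ¬leaf = jump-right-at p descent attach
        where
        q : ℤ
        q = p + 1ℤ
        p<q : p < q
        p<q = i<i+1 p
        open Predecessor u q
        b<q : b < q
        b<q = ascent⇒b<q avoids ascent
        above-b : ∀ {c} → to u b < to u c → c < q → to u q < to u c
        above-b ub<uc c<q = ≤∧≢⇒< (-1<⇒≤ (subst (_< to u _) ub ub<uc)) (λ eq → <-irrefl (sym (to-injective u eq)) c<q)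
        attach : ∀ a → a < p → Bel (to u) a p → to w (to u a) < to w (to u q)
        attach a a<p (ua≤up , bound) = ≮∧≢⇒> (λ vq<va → ¬leaf (subst (to w (to u q) <_) (cong (to w) ub)
                                                  (<-≤-trans vq<va (decreasing a-below-b))))
                                             (λ eq → <-irrefl (sym (to-injective u (to-injective w eq))) a<q)
          where
          a<q : a < q
          a<q = <-trans a<p p<q
          ua<up : to u a < to u p
          ua<up = ≤∧≢⇒< ua≤up λ eq → <-irrefl (to-injective u eq) a<p
          ua<uq : to u a < to u q
          ua<uq = ≮∧≢⇒> (λ uq<ua → avoids a<p p<q uq<ua ua<up) (λ eq → <-irrefl (sym (to-injective u eq)) a<q)
          ua≤ub : to u a ≤ to u b
          ua≤ub = subst (to u a ≤_) (sym ub) (<⇒≤-1 ua<uq)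
          a-below-b : Bel (to u) a b
          a-below-b = ua≤ub , λ where
            c (inj₁ (a<c , c<b)) → ≮⇒≥ λ ub<uc →
              let c<p = <-≤-trans c<b (<+1⇒≤ b<q)
                  uc<up = ≤∧≢⇒< (bound c (inj₁ (a<c , c<p))) λ eq → <-irrefl (to-injective u eq) c<p
              in avoids c<p p<q (above-b ub<uc (<-trans c<p p<q)) uc<up
            c (inj₂ (b<c , c<a)) → ≮⇒≥ λ ub<uc →
              let c<p = <-trans c<a a<p in
              case <-cmp (to u c) (to u p) of λ where
                (tri< uc<up _ _) → avoids c<p p<q (above-b ub<uc (<-trans c<p p<q)) uc<up
                (tri≈ _ eq _)    → <-irrefl (to-injective u eq) c<p
                (tri> _ _ up<uc) → avoids b<c c<a
                  (≤∧≢⇒< ua≤ub λ eq → <-irrefl (sym (to-injective u eq)) (<-trans b<c c<a)) ub<uc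

      -- The lower of the two positions is the middle of a double ascent or a double descent, or
      -- else a valley whose label does not follow a descent of `w`.
      nonleaves⇒jump : ∀ q → ¬ LeafAt w u q → ¬ LeafAt w u (q + 1ℤ) → ∃[ u′ ] (Valid w u′ × ¬ u′ ≈ u)
      nonleaves⇒jump q ¬leaf ¬leaf′ with <-cmp (to u q) (to u (q + 1ℤ))
      ... | tri≈ _ eq _ = ⊥-elim (i≢i+1 q (to-injective u eq))
      ... | tri< q<q+1 _ _ with <-cmp (to u (q - 1ℤ)) (to u q)
      ...   | tri≈ _ eq _ = ⊥-elim (i≢i-1 q (sym (to-injective u eq)))
      ...   | tri< q-1<q _ _ = jump-left-at q q-1<q q<q+1
      ...   | tri> _ _ q<q-1 = valley⇒jump-right (q - 1ℤ)
                (subst (λ z → to u z < to u (q - 1ℤ)) (sym (i-1+1≡i q)) q<q-1)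
                (subst (λ z → to u z < to u (z + 1ℤ)) (sym (i-1+1≡i q)) q<q+1)
                (subst (λ z → ¬ LeafAt w u z) (sym (i-1+1≡i q)) ¬leaf)
      nonleaves⇒jump q ¬leaf ¬leaf′ | tri> _ _ q+1<q with <-cmp (to u (q + 1ℤ)) (to u (q + 1ℤ + 1ℤ))
      ...   | tri≈ _ eq _ = ⊥-elim (i≢i+1 (q + 1ℤ) (to-injective u eq))
      ...   | tri< q+1<q+2 _ _ = valley⇒jump-right q q+1<q q+1<q+2 ¬leaf′
      -- The larger label at q leaves q + 1 without a left child, so the attachment condition is
      -- vacuous.
      ...   | tri> _ _ q+2<q+1 = jump-right-at (q + 1ℤ) q+2<q+1 λ a a<q+1 (ua≤ , bound) →
                ⊥-elim (<⇒≱ q+1<q (case a ≟ q of λ where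
                  (yes refl) → ua≤
                  (no  a≢q)  → bound q (inj₁ (≤∧≢⇒< (<+1⇒≤ a<q+1) a≢q , i<i+1 q))))

      -- Equality forces exactly one leaf into every adjacent pair, so both neighbours of an inner
      -- node are valleys and the node itself is a peak.
      descents⇒fullTree : 2 ℕ.* length (descents w) ≡ n → FullTree (Leaf w) u
      descents⇒fullTree total = record
        { avoids  = avoids
        ; valleyˡ = leaf⇒valleyˡ w val
        ; valleyʳ = leaf⇒valleyʳ w val
        ; peakˡ   = λ {q} ¬leaf → subst (λ z → to u (q - 1ℤ) < to u z) (i-1+1≡i q)
            (leaf⇒valleyʳ w val (decidable-stable (leafAt? w u (q - 1ℤ)) λ ¬leaf′ →
              one (q - 1ℤ) (¬leaf′ , subst (λ z → ¬ LeafAt w u z) (sym (i-1+1≡i q)) ¬leaf)))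
        ; peakʳ   = λ {q} ¬leaf → subst (λ z → to u (q + 1ℤ) < to u z) (i+1-1≡i q)
            (leaf⇒valleyˡ w val (decidable-stable (leafAt? w u (q + 1ℤ)) λ ¬leaf′ → one q (¬leaf , ¬leaf′)))
        }
        where
        one : ∀ q → ¬ (¬ LeafAt w u q × ¬ LeafAt w u (q + 1ℤ))
        one q = leafCount-1⇒leaf w val (descents⇒leafCount w u (leafCount-≤1 w val) total q)

    uniquelySorted⇒≈ : ∀ {w : AP} → UniquelySorted w → ∀ {v v′} → StackSortsTo v w → StackSortsTo v′ w → v ≈ v′
    uniquelySorted⇒≈ {w} bij {v} {v′} s s′ x
      with Fin.zero , eq ← Bijection.strictlySurjective bij (v , s)
      with Fin.zero , eq′ ← Bijection.strictlySurjective bij (v′ , s′) = trans (sym (eq x)) (eq′ x)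

    uniquelySorted⇒descents : ∀ {w : AP} → UniquelySorted w → 2 ℕ.* length (descents w) ≡ n
    uniquelySorted⇒descents {w} bij =
      go (preimage⇒valid {proj₁ (Bijection.to bij Fin.zero)} {w} (proj₂ (Bijection.to bij Fin.zero)))
      where
      go : ∃[ u ] (Valid w u × _) → 2 ℕ.* length (descents w) ≡ n
      go (u , val , _) = all-leafCount⇒descents w u λ i → leafCount-1 w val (pos i) λ (¬leaf , ¬leaf′) →
        let u′ , val′ , u′≉u = nonleaves⇒jump val (pos i) ¬leaf ¬leaf′ in
        u′≉u λ x → to-injective w (uniquelySorted⇒≈ {w} bij {w ∘ᵃ u′} {w ∘ᵃ u}
          (valid⇒preimage {w} {u′} val′) (valid⇒preimage {w} {u} val) x)

    descents⇒uniquelySorted : ∀ {w : AP} → InImage w → 2 ℕ.* length (descents w) ≡ n → UniquelySorted w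
    descents⇒uniquelySorted {w} (v , s) total = record
      { to        = λ _ → v , s
      ; cong      = λ _ _ → refl
      ; bijective = (λ { {Fin.zero} {Fin.zero} _ → refl }) , λ (v′ , s′) → Fin.zero , λ _ → unique {v′} s′
      }
      where
      unique : ∀ {v′} → StackSortsTo v′ w → v ≈ v′
      unique {v′} s′ x =
        let u  , val  , v≗  = preimage⇒valid {v} {w} s
            u′ , val′ , v′≗ = preimage⇒valid {v′} {w} s′
        in trans (v≗ x) (trans (cong (to w)
             (fullTree-unique (leaf? w) (descents⇒fullTree val total) (descents⇒fullTree val′ total) x))
             (sym (v′≗ x)))

open import Data.Nat.Base using (_*_; _≤_)

theorem8p14 : ∀ (n : ℕ) → 2 ≤ n →
    (∀ (w : AffinePermutation n) →
    UniquelySorted w ⇔ (InImage w × 2 * length (descents w) ≡ n)) ×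
    (¬ (2 ∣ n) → ∀ (w : AffinePermutation n) → ¬ UniquelySorted w)
theorem8p14 n 2≤n =
  (λ w → mk⇔
    (λ unique → Bijection.to unique Fin.zero , uniquelySorted⇒descents n 2≤n {w} unique)
    (λ (image , total) → descents⇒uniquelySorted n 2≤n {w} image total)) ,
  λ 2∤n w unique → 2∤n (divides (length (descents w))
    (trans (sym (uniquelySorted⇒descents n 2≤n {w} unique)) (ℕ.*-comm 2 (length (descents w)))))
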